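{- Let $\mathbf{k}=(k_1,k_2)$ and $\mathbf{n}=(n_1,n_2)$ with $k_i<n_i\le m$ for $i\in\{1,2\}$. Then the weight distribution (the numbers $A_i(\mathcal{C})$ of codewords of rank weight $i$, $i=0,\dots,n_1+n_2$) of an $(\mathbf{n},\mathbf{k})$-MRD code $\mathcal{C}\subseteq\mathbb{F}_{q^m}^{n_1+n_2}$ depends only on $\mathbf{n},\mathbf{k},q$ and $m$.
   Context: An $[n,k]_{q^m/q}$ code is a $k$-dim $\mathbb{F}_{q^m}$-subspace of $\mathbb{F}_{q^m}^n$ with rank weight $w(v)=\dim_{\mathbb{F}_q}\langle v_1,\dots,v_n\rangle_{\mathbb{F}_q}$. For $n_i\le m$, an $[n_i,k_i]_{q^m/q}$ code is MRD if its minimum distance is $n_i-k_i+1$. With $N=n_1+n_2$, $K=k_1+k_2$, an $[N,K]_{q^m/q}$ code $\mathcal{C}$ is an $(\mathbf{n},\mathbf{k})$-MRD code if $\mathcal{C}=\mathcal{C}_1\oplus\mathcal{C}_2=\{(c_1,c_2):c_i\in\mathcal{C}_i\}$ for MRD codes $\mathcal{C}_i\subseteq\mathbb{F}_{q^m}^{n_i}$ of parameters $[n_i,k_i]_{q^m/q}$, and every codeword $(c_1,c_2)$ with $c_1\neq0$, $c_2\ne0$ has rank weight at least $N-K+1$. -}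

module Defs where

open import Data.Nat using (ℕ; suc; _∸_; _≤_; _<_) renaming (_+_ to _+ℕ_)
open import Data.Vec using (Vec; []; _∷_; [_]; map; zipWith; replicate; _++_)
open import Data.Vec.Relation.Unary.All using (All)
open import Data.List using (List; length)
open import Data.List.Membership.Propositional using (_∈_)
open import Data.List.Relation.Unary.Unique.Propositional using (Unique)
import Data.List.Relation.Unary.All as ListAll
open import Data.Product using (Σ; ∃; ∃-syntax; _×_; _,_)
open import Data.Sum using (_⊎_)
open import Data.Unit using (⊤)
open import Relation.Binary.PropositionalEquality using (_≡_)
open import Relation.Nullary using (¬_)
open import Algebra.Structures using (IsCommutativeRing)
open import Function.Bundles using (_⇔_)

record Field : Set₁ where
  infixl 6 _+_
  infixl 7 _*_
  field
    Carrier : Set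
    _+_ _*_ : Carrier → Carrier → Carrier
    -_      : Carrier → Carrier
    0# 1#   : Carrier
    isCommutativeRing : IsCommutativeRing _≡_ _+_ _*_ -_ 0# 1#
    0≢1     : ¬ (0# ≡ 1#)
    inverse : ∀ x → ¬ (x ≡ 0#) → ∃[ y ] (x * y ≡ 1#)

record Subfield (L : Field) : Set₁ where
  open Field L
  field
    In     : Carrier → Set
    in-0   : In 0#
    in-1   : In 1#
    in-+   : ∀ {x y} → In x → In y → In (x + y)
    in-*   : ∀ {x y} → In x → In y → In (x * y)
    in--   : ∀ {x} → In x → In (- x)
    in-inv : ∀ {x y} → In x → x * y ≡ 1# → In y

-- Linear algebra in L^n with scalars restricted to a predicate S ⊆ L
-- (S = everything gives L-linear algebra, S = a subfield K gives K-linear algebra).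

module LinAlg (L : Field) where
  open Field L

  zeroV : ∀ {n} → Vec Carrier n
  zeroV = replicate _ 0#

  _⊕_ : ∀ {n} → Vec Carrier n → Vec Carrier n → Vec Carrier n
  _⊕_ = zipWith _+_

  _·_ : ∀ {n} → Carrier → Vec Carrier n → Vec Carrier n
  c · v = map (c *_) v

  lincomb : ∀ {n r} → Vec Carrier r → Vec (Vec Carrier n) r → Vec Carrier n
  lincomb []       []       = zeroV
  lincomb (c ∷ cs) (v ∷ vs) = (c · v) ⊕ lincomb cs vs

  InSpan : (S : Carrier → Set) → ∀ {n r} → Vec (Vec Carrier n) r → Vec Carrier n → Set
  InSpan S {r = r} vs v = Σ (Vec Carrier r) λ cs → All S cs × lincomb cs vs ≡ v

  Independent : (S : Carrier → Set) → ∀ {n r} → Vec (Vec Carrier n) r → Set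
  Independent S {r = r} vs =
    ∀ (cs : Vec Carrier r) → All S cs → lincomb cs vs ≡ zeroV → cs ≡ replicate r 0#

  HasDim : (S : Carrier → Set) → ∀ {n} → (Vec Carrier n → Set) → ℕ → Set
  HasDim S {n} W d = Σ (Vec (Vec Carrier n) d) λ b →
    All W b × Independent S b × (∀ v → W v → InSpan S b v)

  Everything : Carrier → Set
  Everything _ = ⊤

record Extension (q m : ℕ) : Set₁ where
  field
    L : Field
    K : Subfield L
  open Field L public
  open Subfield K public using (In)
  open LinAlg L public
  field
    K-elems    : List Carrier
    K-unique   : Unique K-elems
    K-sound    : ListAll.All In K-elems
    K-complete : ∀ x → In x → x ∈ K-elems
    K-card     : length K-elems ≡ q
    -- L has dimension m over K (elements of L viewed as vectors of length 1)
    degree     : HasDim In (λ (_ : Vec Carrier 1) → ⊤) m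

module Codes {q m : ℕ} (E : Extension q m) where
  open Extension E

  RankWeight : ∀ {n} → Vec Carrier n → ℕ → Set
  RankWeight v r = HasDim In (InSpan In (map [_] v)) r

  record LinearCode (n k : ℕ) (C : Vec Carrier n → Set) : Set where
    field
      has-0 : C zeroV
      has-+ : ∀ {u v} → C u → C v → C (u ⊕ v)
      has-· : ∀ c {v} → C v → C (c · v)
      dim   : HasDim Everything C k

  -- minimum (rank) distance of a code is d
  -- (convention: the zero code has minimum distance n+1)
  MinDistance : ∀ {n} → (Vec Carrier n → Set) → ℕ → Set
  MinDistance {n} C d =
    (∀ c → C c → ¬ (c ≡ zeroV) → ∀ r → RankWeight c r → d ≤ r)
    × ((∃[ c ] (C c × ¬ (c ≡ zeroV) × RankWeight c d))
       ⊎ ((∀ c → C c → c ≡ zeroV) × d ≡ suc n))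

  MRD : (n k : ℕ) → (Vec Carrier n → Set) → Set
  MRD n k C = LinearCode n k C × MinDistance C (suc (n ∸ k))

  record SumMRD (n₁ n₂ k₁ k₂ : ℕ) (C : Vec Carrier (n₁ +ℕ n₂) → Set) : Set₁ where
    field
      code : LinearCode (n₁ +ℕ n₂) (k₁ +ℕ k₂) C
      C₁   : Vec Carrier n₁ → Set
      C₂   : Vec Carrier n₂ → Set
      C₁-MRD : MRD n₁ k₁ C₁
      C₂-MRD : MRD n₂ k₂ C₂
      direct-sum : ∀ (c₁ : Vec Carrier n₁) (c₂ : Vec Carrier n₂) → C (c₁ ++ c₂) ⇔ (C₁ c₁ × C₂ c₂)
      weight-bound : ∀ (c₁ : Vec Carrier n₁) (c₂ : Vec Carrier n₂) →
        C₁ c₁ → C₂ c₂ → ¬ (c₁ ≡ zeroV) → ¬ (c₂ ≡ zeroV) →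
        ∀ r → RankWeight (c₁ ++ c₂) r → suc ((n₁ +ℕ n₂) ∸ (k₁ +ℕ k₂)) ≤ r

  WeightCount : ∀ {n} → (Vec Carrier n → Set) → ℕ → ℕ → Set
  WeightCount {n} C i a = Σ (List (Vec Carrier n)) λ xs →
    Unique xs × ListAll.All (λ c → C c × RankWeight c i) xs
    × (∀ c → C c → RankWeight c i → c ∈ xs) × length xs ≡ a

{-# OPTIONS --safe #-}
module Submission where

-- For c ∈ Lᴺ let ker c = { x ∈ Kᴺ : c · x = 0 }; then |ker c| = qᴺ⁻ʷ⁽ᶜ⁾, so the weight distribution
-- is the distribution of the numbers |ker c|, and it suffices to find their power sums. By double
-- counting, Σ_c |ker c|ᵗ is the sum, over all t-tuples X of vectors of Kᴺ, of the number of codewords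
-- orthogonal to X. If u, a, b are the ranks of X and of its projections to the two blocks, this number
-- is qᵐˢ with s = max(0, k₁ + k₂ - u, k₁ - a, k₂ - b): every new equation divides the number by at most
-- qᵐ, which gives the lower bound; conversely X can be extended by a vector that raises every rank
-- not yet maximal, and once s = 0 the weight bounds leave only the zero codeword. Finally, the number
-- of tuples with given ranks obeys a recursion involving only q, n₁ and n₂.

open import Defs
open import Algebra.Bundles using (CommutativeRing)
import Algebra.Properties.CommutativeSemigroup
import Algebra.Properties.Ring
open import Data.Bool using (true; false; if_then_else_)
open import Data.Integer as ℤ using (ℤ)
import Data.Integer.Properties as ℤ
open import Data.Integer.Solver using (module +-*-Solver)
open import Data.List as List using (List; []; _∷_; length; filter; cartesianProductWith)
open import Data.List.Membership.Propositional using (_∈_; find; lose)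
open import Data.List.Membership.Propositional.Properties as ∈ using (∈-filter⁺; ∈-filter⁻; ∈-map⁺; ∈-map⁻; ∈-∃++; ∈-cartesianProductWith⁺; ∈-cartesianProductWith⁻)
import Data.List.Properties as List
import Data.List.Relation.Unary.All as ListAll
open import Data.List.Relation.Unary.All.Properties using (¬All⇒Any¬)
open import Data.List.Relation.Unary.AllPairs using ([]; _∷_)
open import Data.List.Relation.Unary.Any as Any using (here; there)
open import Data.List.Relation.Unary.Unique.Propositional using (Unique)
import Data.List.Relation.Unary.Unique.Propositional.Properties as Unique
open import Data.Nat using (ℕ; zero; suc; _+_; _*_; _∸_; _^_; _⊔_; _≤_; _<_; z≤n; s≤s; _≤?_; _<?_; NonZero; >-nonZero)
open import Data.Nat.ListAction using (sum)
open import Data.Nat.Properties hiding (_≟_)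
import Data.Nat.Properties as ℕ
open import Data.Product using (Σ; ∃; _×_; _,_; proj₁; proj₂)
open import Data.Sum using (_⊎_; inj₁; inj₂)
open import Data.Unit using (tt)
open import Data.Vec as Vec using (Vec; []; _∷_; _++_; take; drop)
import Data.Vec.Properties as Vec
open import Data.Vec.Relation.Unary.All as VecAll using (All; []; _∷_; all?)
open import Function using (_∘_; id)
open import Function.Bundles using (Equivalence)
open import Relation.Binary.Definitions using (DecidableEquality)
open import Relation.Binary.PropositionalEquality
open import Relation.Nullary using (¬_; Dec; yes; no; does; contradiction)
open import Relation.Nullary.Decidable using (¬?)
open import Relation.Unary using (Decidable)

open Algebra.Properties.CommutativeSemigroup +-commutativeSemigroup using () renaming (interchange to +-interchange)

-- Finite sums

-- The bound for a nonzero codeword supported on one block is only `n₁ - k₁ + 1` or `n₂ - k₂ + 1`,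
-- smaller than the bound `N - K + 1` for the remaining ones, so no single minimum distance governs
-- the count. Each of the three weight bounds speaks about a different rank: that of X for codewords
-- with two nonzero blocks, those of the projections for codewords living in one block. Hence three
-- deficits and their maximum. The delicate direction is the upper bound: each extension of X costs
-- a factor qᵐ, so one vector has to lower all three deficits at once; lowering them in turn would
-- only give their sum. This is possible because a vector with a projection outside the
-- corresponding span is itself outside the span of X. Power sums suffice because |ker c| takes
-- finitely many values, which polynomials separate. As X runs over all tuples, dependent ones
-- included, the sums are plain powers, and no system with Gaussian binomials has to be inverted.

sumOver : {A : Set} → List A → (A → ℕ) → ℕ
sumOver xs f = sum (List.map f xs)

indicator : {P : Set} → Dec P → ℕ
indicator d = if does d then 1 else 0

indicator-yes : {P : Set} (d : Dec P) → P → indicator d ≡ 1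
indicator-yes (yes _) _ = refl
indicator-yes (no ¬p) p = contradiction p ¬p

indicator-no : {P : Set} (d : Dec P) → ¬ P → indicator d ≡ 0
indicator-no (yes p) ¬p = contradiction p ¬p
indicator-no (no _)  _  = refl

module _ {A : Set} where

  sumOver-cong : ∀ (xs : List A) {f g : A → ℕ} → (∀ {x} → x ∈ xs → f x ≡ g x) →
                 sumOver xs f ≡ sumOver xs g
  sumOver-cong []       eq = refl
  sumOver-cong (x ∷ xs) eq = cong₂ _+_ (eq (here refl)) (sumOver-cong xs (eq ∘ there))

  sumOver-mono : ∀ (xs : List A) {f g : A → ℕ} → (∀ {x} → x ∈ xs → f x ≤ g x) →
                 sumOver xs f ≤ sumOver xs g
  sumOver-mono []       le = z≤n
  sumOver-mono (x ∷ xs) le = +-mono-≤ (le (here refl)) (sumOver-mono xs (le ∘ there))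

  sumOver-const : ∀ (xs : List A) k → sumOver xs (λ _ → k) ≡ length xs * k
  sumOver-const []       k = refl
  sumOver-const (x ∷ xs) k = cong (k +_) (sumOver-const xs k)

  sumOver-+ : ∀ (xs : List A) f g →
              sumOver xs (λ x → f x + g x) ≡ sumOver xs f + sumOver xs g
  sumOver-+ []       f g = refl
  sumOver-+ (x ∷ xs) f g =
    trans (cong (f x + g x +_) (sumOver-+ xs f g))
          (+-interchange (f x) (g x) (sumOver xs f) (sumOver xs g))

  sumOver-*ʳ : ∀ (xs : List A) f k → sumOver xs (λ x → f x * k) ≡ sumOver xs f * k
  sumOver-*ʳ []       f k = refl
  sumOver-*ʳ (x ∷ xs) f k = trans (cong (f x * k +_) (sumOver-*ʳ xs f k)) (sym (*-distribʳ-+ k (f x) _))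

  sumOver-*ˡ : ∀ (xs : List A) k f → sumOver xs (λ x → k * f x) ≡ k * sumOver xs f
  sumOver-*ˡ []       k f = sym (*-zeroʳ k)
  sumOver-*ˡ (x ∷ xs) k f = trans (cong (k * f x +_) (sumOver-*ˡ xs k f)) (sym (*-distribˡ-+ k (f x) _))

  sumOver-++ : ∀ (xs ys : List A) f → sumOver (xs List.++ ys) f ≡ sumOver xs f + sumOver ys f
  sumOver-++ []       ys f = refl
  sumOver-++ (x ∷ xs) ys f = trans (cong (f x +_) (sumOver-++ xs ys f)) (sym (+-assoc (f x) _ _))

  length-filter : {P : A → Set} (P? : Decidable P) (xs : List A) →
                  length (filter P? xs) ≡ sumOver xs (λ x → indicator (P? x))
  length-filter P? []       = refl
  length-filter P? (x ∷ xs) with does (P? x)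
  ... | true  = cong suc (length-filter P? xs)
  ... | false = length-filter P? xs

  sumOver-indicator≡0 : (_≟_ : DecidableEquality A) (z : A) (ys : List A) → ¬ z ∈ ys →
                        sumOver ys (λ y → indicator (z ≟ y)) ≡ 0
  sumOver-indicator≡0 _≟_ z []       z∉ = refl
  sumOver-indicator≡0 _≟_ z (y ∷ ys) z∉ =
    cong₂ _+_ (indicator-no (z ≟ y) (z∉ ∘ here)) (sumOver-indicator≡0 _≟_ z ys (z∉ ∘ there))

  sumOver-indicator≡1 : (_≟_ : DecidableEquality A) (z : A) {ys : List A} → Unique ys → z ∈ ys →
                        sumOver ys (λ y → indicator (z ≟ y)) ≡ 1
  sumOver-indicator≡1 _≟_ z (y∉ ∷ u) (here refl) =
    cong₂ _+_ (indicator-yes (z ≟ z) refl)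
              (sumOver-indicator≡0 _≟_ z _ (λ z∈ → ListAll.lookup y∉ z∈ refl))
  sumOver-indicator≡1 _≟_ z {y ∷ _} (y∉ ∷ u) (there z∈) =
    cong₂ _+_ (indicator-no (z ≟ y) (λ z≡y → ListAll.lookup y∉ z∈ (sym z≡y)))
              (sumOver-indicator≡1 _≟_ z u z∈)

module _ {A B : Set} where

  sumOver-swap : ∀ (xs : List A) (ys : List B) (f : A → B → ℕ) →
                 sumOver xs (λ x → sumOver ys (f x)) ≡ sumOver ys (λ y → sumOver xs (λ x → f x y))
  sumOver-swap []       ys f = sym (trans (sumOver-const ys 0) (*-zeroʳ (length ys)))
  sumOver-swap (x ∷ xs) ys f =
    trans (cong (sumOver ys (f x) +_) (sumOver-swap xs ys f)) (sym (sumOver-+ ys (f x) _))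

  sumOver-map : ∀ (g : A → B) (xs : List A) (f : B → ℕ) →
                sumOver (List.map g xs) f ≡ sumOver xs (f ∘ g)
  sumOver-map g []       f = refl
  sumOver-map g (x ∷ xs) f = cong (f (g x) +_) (sumOver-map g xs f)

sumOver-cartesianProductWith : {A B C : Set} (g : A → B → C) (xs : List A) (ys : List B) (f : C → ℕ) →
  sumOver (cartesianProductWith g xs ys) f ≡ sumOver xs (λ x → sumOver ys (λ y → f (g x y)))
sumOver-cartesianProductWith g []       ys f = refl
sumOver-cartesianProductWith g (x ∷ xs) ys f =
  trans (sumOver-++ (List.map (g x) ys) _ f)
        (cong₂ _+_ (sumOver-map (g x) ys f) (sumOver-cartesianProductWith g xs ys f))

length-cartesianProductWith : {A B C : Set} (g : A → B → C) (xs : List A) (ys : List B) →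
  length (cartesianProductWith g xs ys) ≡ length xs * length ys
length-cartesianProductWith g []       ys = refl
length-cartesianProductWith g (x ∷ xs) ys =
  trans (List.length-++ (List.map (g x) ys))
        (cong₂ _+_ (List.length-map (g x) ys) (length-cartesianProductWith g xs ys))

-- Enumerations of predicates

-- Pigeonhole by deletion: the head of `xs` is cut out of `ys`, and uniqueness ensures that the tail
-- never needs the deleted entry.
Unique-⊆⇒length≤ : {A : Set} {xs ys : List A} → Unique xs → (∀ {x} → x ∈ xs → x ∈ ys) →
                   length xs ≤ length ys
Unique-⊆⇒length≤ {xs = []}     _        _   = z≤n
Unique-⊆⇒length≤ {xs = x ∷ xs} (x∉ ∷ u) sub with ∈-∃++ (sub (here refl))
... | as , bs , refl = begin
  suc (length xs)               ≤⟨ s≤s (Unique-⊆⇒length≤ u sub′) ⟩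
  suc (length (as List.++ bs))  ≡⟨ cong suc (List.length-++ as) ⟩
  suc (length as + length bs)   ≡⟨ +-suc (length as) (length bs) ⟨
  length as + suc (length bs)   ≡⟨ List.length-++ as ⟨
  length (as List.++ x ∷ bs)    ∎
  where
  open ≤-Reasoning
  sub′ : ∀ {y} → y ∈ xs → y ∈ as List.++ bs
  sub′ y∈ with ∈.∈-++⁻ as (sub (there y∈))
  ... | inj₁ y∈as         = ∈.∈-++⁺ˡ y∈as
  ... | inj₂ (here refl)  = contradiction refl (ListAll.lookup x∉ y∈)
  ... | inj₂ (there y∈bs) = ∈.∈-++⁺ʳ as y∈bs

Unique-map : {A B : Set} (f : A → B) {xs : List A} →
             (∀ {x y} → x ∈ xs → y ∈ xs → f x ≡ f y → x ≡ y) → Unique xs → Unique (List.map f xs)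
Unique-map f inj []       = []
Unique-map f inj (x∉ ∷ u) =
  ListAll.tabulate (λ fy∈ fx≡ → let y , y∈ , eq = ∈-map⁻ f fy∈ in
    ListAll.lookup x∉ y∈ (inj (here refl) (there y∈) (trans fx≡ eq)))
  ∷ Unique-map f (λ x∈ y∈ → inj (there x∈) (there y∈)) u

-- Codes and spans are bare predicates with no decision procedure. A duplicate-free list of the
-- members gives a well-defined size, and sizes can be compared through maps without deciding
-- membership.
record Enumeration {A : Set} (P : A → Set) : Set where
  field
    elems    : List A
    unique   : Unique elems
    sound    : ∀ {x} → x ∈ elems → P x
    complete : ∀ {x} → P x → x ∈ elems

  size : ℕ
  size = length elems

open Enumeration

module _ {A B : Set} {P : A → Set} {Q : B → Set} where

  size-injection : (e : Enumeration P) (e′ : Enumeration Q) (f : A → B) → (∀ {x} → P x → Q (f x)) →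
                   (∀ {x y} → P x → P y → f x ≡ f y → x ≡ y) → size e ≤ size e′
  size-injection e e′ f maps inj = subst (_≤ size e′) (List.length-map f (elems e))
    (Unique-⊆⇒length≤ (Unique-map f (λ x∈ y∈ → inj (sound e x∈) (sound e y∈)) (unique e))
      (λ y∈ → let x , x∈ , eq = ∈-map⁻ f y∈ in
        subst (_∈ elems e′) (sym eq) (complete e′ (maps (sound e x∈)))))

  image : Enumeration P → (f : A → B) → (∀ {x} → P x → Q (f x)) →
          (∀ {x y} → P x → P y → f x ≡ f y → x ≡ y) → (∀ {y} → Q y → ∃ λ x → P x × f x ≡ y) →
          Enumeration Q
  image e f maps inj surj = record
    { elems    = List.map f (elems e)
    ; unique   = Unique-map f (λ x∈ y∈ → inj (sound e x∈) (sound e y∈)) (unique e)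
    ; sound    = λ y∈ → let x , x∈ , eq = ∈-map⁻ f y∈ in subst Q (sym eq) (maps (sound e x∈))
    ; complete = λ qy → let x , px , eq = surj qy in
        subst (_∈ List.map f (elems e)) eq (∈-map⁺ f (complete e px))
    }

size-mono : {A : Set} {P Q : A → Set} (e : Enumeration P) (e′ : Enumeration Q) →
            (∀ {x} → P x → Q x) → size e ≤ size e′
size-mono e e′ sub = size-injection e e′ id sub (λ _ _ → id)

size-cong : {A : Set} {P Q : A → Set} (e : Enumeration P) (e′ : Enumeration Q) →
            (∀ {x} → P x → Q x) → (∀ {x} → Q x → P x) → size e ≡ size e′
size-cong e e′ to from = ≤-antisym (size-mono e e′ to) (size-mono e′ e from)

module _ {A : Set} {P : A → Set} where

  restrict : {Q : A → Set} → Enumeration P → Decidable Q → Enumeration (λ x → P x × Q x)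
  restrict e Q? = record
    { elems    = filter Q? (elems e)
    ; unique   = Unique.filter⁺ Q? (unique e)
    ; sound    = λ x∈ → let x∈e , qx = ∈-filter⁻ Q? x∈ in sound e x∈e , qx
    ; complete = λ (px , qx) → ∈-filter⁺ Q? (complete e px) qx
    }

  size-inhabited : (e : Enumeration P) {x : A} → P x → 1 ≤ size e
  size-inhabited e px with elems e | complete e px
  ... | _ ∷ _ | _ = s≤s z≤n

  escapes : {Q : A → Set} (e : Enumeration P) (e′ : Enumeration Q) → Decidable P →
            size e < size e′ → ∃ λ x → Q x × ¬ P x
  escapes e e′ P? lt with ListAll.all? P? (elems e′)
  ... | yes all = contradiction
        (size-mono e′ e (λ qx → ListAll.lookup all (complete e′ qx))) (<⇒≱ lt)
  ... | no ¬all = let x , x∈ , ¬px = find (¬All⇒Any¬ P? _ ¬all) in x , sound e′ x∈ , ¬px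

  -- Double counting of the pairs with `φ x ≡ y`: every `x` meets exactly one entry of the
  -- duplicate-free list of values.
  size-fibres : {B : Set} {R : B → Set} (_≟_ : DecidableEquality B) (e : Enumeration P)
                (e′ : Enumeration R) (φ : A → B) → (∀ {x} → P x → R (φ x)) →
                size e ≡ sumOver (elems e′) (λ y → size (restrict e (λ x → φ x ≟ y)))
  size-fibres _≟_ e e′ φ maps = begin
    size e
      ≡⟨ *-identityʳ (size e) ⟨
    size e * 1
      ≡⟨ sumOver-const (elems e) 1 ⟨
    sumOver (elems e) (λ _ → 1)
      ≡⟨ sumOver-cong (elems e) (λ {x} x∈ → sumOver-indicator≡1 _≟_ (φ x) (unique e′) (complete e′ (maps (sound e x∈)))) ⟨
    sumOver (elems e) (λ x → sumOver (elems e′) (λ y → indicator (φ x ≟ y)))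
      ≡⟨ sumOver-swap (elems e) (elems e′) _ ⟩
    sumOver (elems e′) (λ y → sumOver (elems e) (λ x → indicator (φ x ≟ y)))
      ≡⟨ sumOver-cong (elems e′) (λ {y} _ → length-filter (λ x → φ x ≟ y) (elems e)) ⟨
    sumOver (elems e′) (λ y → size (restrict e (λ x → φ x ≟ y)))
      ∎
    where open ≡-Reasoning

-- Vectors with entries in an enumerated set

module _ {A : Set} where

  vectors : List A → (n : ℕ) → List (Vec A n)
  vectors xs zero    = [] ∷ []
  vectors xs (suc n) = cartesianProductWith _∷_ xs (vectors xs n)

  length-vectors : ∀ xs n → length (vectors xs n) ≡ length xs ^ n
  length-vectors xs zero    = refl
  length-vectors xs (suc n) =
    trans (length-cartesianProductWith _∷_ xs (vectors xs n)) (cong (length xs *_) (length-vectors xs n))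

  sumOver-vectors-++ : ∀ xs m {n} (f : Vec A (m + n) → ℕ) →
    sumOver (vectors xs (m + n)) f ≡ sumOver (vectors xs m) (λ u → sumOver (vectors xs n) (λ v → f (u ++ v)))
  sumOver-vectors-++ xs zero    f = sym (+-identityʳ _)
  sumOver-vectors-++ xs (suc m) f = begin
    sumOver (vectors xs (suc m + _)) f
      ≡⟨ sumOver-cartesianProductWith _∷_ xs _ f ⟩
    sumOver xs (λ x → sumOver (vectors xs (m + _)) (λ w → f (x ∷ w)))
      ≡⟨ sumOver-cong xs (λ {x} _ → sumOver-vectors-++ xs m (λ w → f (x ∷ w))) ⟩
    sumOver xs (λ x → sumOver (vectors xs m) (λ u → sumOver (vectors xs _) (λ v → f (x ∷ u ++ v))))
      ≡⟨ sumOver-cartesianProductWith _∷_ xs (vectors xs m) _ ⟨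
    sumOver (vectors xs (suc m)) (λ u → sumOver (vectors xs _) (λ v → f (u ++ v)))
      ∎
    where open ≡-Reasoning

  vectorsOf : {P : A → Set} → Enumeration P → (n : ℕ) → Enumeration (All P {n})
  vectorsOf {P} e n = record
    { elems = vectors (elems e) n ; unique = uniq n ; sound = snd n ; complete = compl }
    where
    uniq : ∀ n → Unique (vectors (elems e) n)
    uniq zero    = ListAll.[] ∷ []
    uniq (suc n) = Unique.cartesianProductWith⁺ _∷_ Vec.∷-injective (unique e) (uniq n)
    snd : ∀ n {v} → v ∈ vectors (elems e) n → All P v
    snd zero    {[]} _ = []
    snd (suc n) v∈ with ∈-cartesianProductWith⁻ _∷_ (elems e) (vectors (elems e) n) v∈
    ... | x , v , x∈ , v∈′ , refl = sound e x∈ ∷ snd n v∈′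
    compl : ∀ {n} {v} → All P v → v ∈ vectors (elems e) n
    compl []        = here refl
    compl (px ∷ pv) = ∈-cartesianProductWith⁺ _∷_ (complete e px) (compl pv)

-- Linear algebra

module Vectors (L : Field) where
  open Field L hiding (_+_; _*_)
  open Field L using () renaming (_+_ to _+ᴸ_; _*_ to _*ᴸ_)
  open LinAlg L

  commutativeRing : CommutativeRing _ _
  commutativeRing = record { isCommutativeRing = isCommutativeRing }

  module R = CommutativeRing commutativeRing
  open Algebra.Properties.Ring R.ring using (-‿distribˡ-*)
  open Algebra.Properties.CommutativeSemigroup R.+-commutativeSemigroup
    using () renaming (interchange to +ᴸ-interchange)

  infixl 6 _⊖_
  _⊖_ : ∀ {n} → Vec Carrier n → Vec Carrier n → Vec Carrier n
  u ⊖ v = u ⊕ ((- 1#) · v)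

  ⊕-assoc : ∀ {n} (u v w : Vec Carrier n) → (u ⊕ v) ⊕ w ≡ u ⊕ (v ⊕ w)
  ⊕-assoc = Vec.zipWith-assoc R.+-assoc

  ⊕-comm : ∀ {n} (u v : Vec Carrier n) → u ⊕ v ≡ v ⊕ u
  ⊕-comm = Vec.zipWith-comm R.+-comm

  ⊕-identityˡ : ∀ {n} (v : Vec Carrier n) → zeroV ⊕ v ≡ v
  ⊕-identityˡ = Vec.zipWith-identityˡ R.+-identityˡ

  ⊕-identityʳ : ∀ {n} (v : Vec Carrier n) → v ⊕ zeroV ≡ v
  ⊕-identityʳ = Vec.zipWith-identityʳ R.+-identityʳ

  ⊕-interchange : ∀ {n} (a b c d : Vec Carrier n) → (a ⊕ b) ⊕ (c ⊕ d) ≡ (a ⊕ c) ⊕ (b ⊕ d)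
  ⊕-interchange []       []       []       []       = refl
  ⊕-interchange (a ∷ as) (b ∷ bs) (c ∷ cs) (d ∷ ds) =
    cong₂ _∷_ (+ᴸ-interchange a b c d) (⊕-interchange as bs cs ds)

  ·-distribˡ-⊕ : ∀ c {n} (u v : Vec Carrier n) → c · (u ⊕ v) ≡ (c · u) ⊕ (c · v)
  ·-distribˡ-⊕ c []      []      = refl
  ·-distribˡ-⊕ c (x ∷ u) (y ∷ v) = cong₂ _∷_ (R.distribˡ c x y) (·-distribˡ-⊕ c u v)

  ·-distribʳ-+ : ∀ c d {n} (v : Vec Carrier n) → (c +ᴸ d) · v ≡ (c · v) ⊕ (d · v)
  ·-distribʳ-+ c d []      = refl
  ·-distribʳ-+ c d (x ∷ v) = cong₂ _∷_ (R.distribʳ x c d) (·-distribʳ-+ c d v)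

  ·-assoc : ∀ c d {n} (v : Vec Carrier n) → (c *ᴸ d) · v ≡ c · (d · v)
  ·-assoc c d []      = refl
  ·-assoc c d (x ∷ v) = cong₂ _∷_ (R.*-assoc c d x) (·-assoc c d v)

  ·-identity : ∀ {n} (v : Vec Carrier n) → 1# · v ≡ v
  ·-identity []      = refl
  ·-identity (x ∷ v) = cong₂ _∷_ (R.*-identityˡ x) (·-identity v)

  ·-zeroˡ : ∀ {n} (v : Vec Carrier n) → 0# · v ≡ zeroV
  ·-zeroˡ []      = refl
  ·-zeroˡ (x ∷ v) = cong₂ _∷_ (R.zeroˡ x) (·-zeroˡ v)

  ·-zeroʳ : ∀ c {n} → c · zeroV {n} ≡ zeroV
  ·-zeroʳ c {zero}  = refl
  ·-zeroʳ c {suc n} = cong₂ _∷_ (R.zeroʳ c) (·-zeroʳ c)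

  ⊖-inverse : ∀ {n} (v : Vec Carrier n) → v ⊖ v ≡ zeroV
  ⊖-inverse v = begin
    v ⊕ ((- 1#) · v)            ≡⟨ cong (_⊕ ((- 1#) · v)) (·-identity v) ⟨
    (1# · v) ⊕ ((- 1#) · v)     ≡⟨ ·-distribʳ-+ 1# (- 1#) v ⟨
    (1# +ᴸ (- 1#)) · v          ≡⟨ cong (_· v) (R.-‿inverseʳ 1#) ⟩
    0# · v                      ≡⟨ ·-zeroˡ v ⟩
    zeroV                       ∎
    where open ≡-Reasoning

  ⊕-cancelʳ : ∀ {n} (w : Vec Carrier n) {u v} → u ⊕ w ≡ v ⊕ w → u ≡ v
  ⊕-cancelʳ w {u} {v} eq = trans (sym (add-sub u)) (trans (cong (_⊖ w) eq) (add-sub v))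
    where
    add-sub : ∀ u → (u ⊕ w) ⊖ w ≡ u
    add-sub u = trans (⊕-assoc u w _) (trans (cong (u ⊕_) (⊖-inverse w)) (⊕-identityʳ u))

  ⊖-cancelʳ : ∀ {n} (w : Vec Carrier n) {u v} → u ⊖ w ≡ v ⊖ w → u ≡ v
  ⊖-cancelʳ w = ⊕-cancelʳ ((- 1#) · w)

  ⊖≡0⇒≡ : ∀ {n} {u v : Vec Carrier n} → u ⊖ v ≡ zeroV → u ≡ v
  ⊖≡0⇒≡ {v = v} eq = ⊖-cancelʳ v (trans eq (sym (⊖-inverse v)))

  lincomb-⊕ : ∀ {n r} (cs ds : Vec Carrier r) (vs : Vec (Vec Carrier n) r) →
              lincomb (cs ⊕ ds) vs ≡ lincomb cs vs ⊕ lincomb ds vs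
  lincomb-⊕ []       []       []       = sym (⊕-identityˡ zeroV)
  lincomb-⊕ (c ∷ cs) (d ∷ ds) (v ∷ vs) =
    trans (cong₂ _⊕_ (·-distribʳ-+ c d v) (lincomb-⊕ cs ds vs)) (⊕-interchange _ _ _ _)

  lincomb-· : ∀ c {n r} (cs : Vec Carrier r) (vs : Vec (Vec Carrier n) r) →
              lincomb (c · cs) vs ≡ c · lincomb cs vs
  lincomb-· c []       []       = sym (·-zeroʳ c)
  lincomb-· c (d ∷ cs) (v ∷ vs) =
    trans (cong₂ _⊕_ (·-assoc c d v) (lincomb-· c cs vs)) (sym (·-distribˡ-⊕ c _ _))

  lincomb-zero : ∀ {n r} (vs : Vec (Vec Carrier n) r) → lincomb zeroV vs ≡ zeroV
  lincomb-zero []       = refl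
  lincomb-zero (v ∷ vs) = trans (cong₂ _⊕_ (·-zeroˡ v) (lincomb-zero vs)) (⊕-identityˡ zeroV)

  lincomb-⊖ : ∀ {n r} (cs ds : Vec Carrier r) (vs : Vec (Vec Carrier n) r) →
              lincomb (cs ⊖ ds) vs ≡ lincomb cs vs ⊖ lincomb ds vs
  lincomb-⊖ cs ds vs =
    trans (lincomb-⊕ cs _ vs) (cong (lincomb cs vs ⊕_) (lincomb-· (- 1#) ds vs))

  -- The order of the factors makes `dot c x` literally the combination of the entries of `c` with
  -- coefficients `x`.
  dot : ∀ {n} → Vec Carrier n → Vec Carrier n → Carrier
  dot []       []       = 0#
  dot (c ∷ cs) (x ∷ xs) = (x *ᴸ c) +ᴸ dot cs xs

  -- The bridge between weights and kernels: the span whose dimension is the rank weight of `c` is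
  -- the image of the pairing with `c`.
  lincomb-singletons : ∀ {n} (xs cs : Vec Carrier n) →
                       lincomb xs (Vec.map Vec.[_] cs) ≡ dot cs xs ∷ []
  lincomb-singletons []       []       = refl
  lincomb-singletons (x ∷ xs) (c ∷ cs) rewrite lincomb-singletons xs cs = refl

  dot-⊕ˡ : ∀ {n} (b c x : Vec Carrier n) → dot (b ⊕ c) x ≡ dot b x +ᴸ dot c x
  dot-⊕ˡ []       []       []       = sym (R.+-identityˡ 0#)
  dot-⊕ˡ (b ∷ bs) (c ∷ cs) (x ∷ xs) =
    trans (cong₂ _+ᴸ_ (R.distribˡ x b c) (dot-⊕ˡ bs cs xs)) (+ᴸ-interchange _ _ _ _)

  dot-·ˡ : ∀ k {n} (c x : Vec Carrier n) → dot (k · c) x ≡ k *ᴸ dot c x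
  dot-·ˡ k []       []       = sym (R.zeroʳ k)
  dot-·ˡ k (c ∷ cs) (x ∷ xs) = trans (cong₂ _+ᴸ_ x[kc]≡k[xc] (dot-·ˡ k cs xs)) (sym (R.distribˡ k _ _))
    where
    x[kc]≡k[xc] : x *ᴸ (k *ᴸ c) ≡ k *ᴸ (x *ᴸ c)
    x[kc]≡k[xc] = trans (sym (R.*-assoc x k c)) (trans (cong (_*ᴸ c) (R.*-comm x k)) (R.*-assoc k x c))

  dot-zeroˡ : ∀ {n} (x : Vec Carrier n) → dot zeroV x ≡ 0#
  dot-zeroˡ []      = refl
  dot-zeroˡ (x ∷ v) = trans (cong₂ _+ᴸ_ (R.zeroʳ x) (dot-zeroˡ v)) (R.+-identityˡ 0#)

  dot-⊖ˡ : ∀ {n} (b c x : Vec Carrier n) → dot b x ≡ dot c x → dot (b ⊖ c) x ≡ 0#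
  dot-⊖ˡ b c x eq = begin
    dot (b ⊖ c) x                        ≡⟨ dot-⊕ˡ b _ x ⟩
    dot b x +ᴸ dot ((- 1#) · c) x        ≡⟨ cong₂ _+ᴸ_ eq (dot-·ˡ (- 1#) c x) ⟩
    dot c x +ᴸ ((- 1#) *ᴸ dot c x)       ≡⟨ cong (dot c x +ᴸ_) (-‿distribˡ-* 1# (dot c x)) ⟨
    dot c x +ᴸ (- (1# *ᴸ dot c x))       ≡⟨ cong (λ y → dot c x +ᴸ (- y)) (R.*-identityˡ _) ⟩
    dot c x +ᴸ (- dot c x)               ≡⟨ R.-‿inverseʳ _ ⟩
    0#                                   ∎
    where open ≡-Reasoning

  dot-comm : ∀ {n} (c x : Vec Carrier n) → dot c x ≡ dot x c
  dot-comm []       []       = refl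
  dot-comm (c ∷ cs) (x ∷ xs) = cong₂ _+ᴸ_ (R.*-comm x c) (dot-comm cs xs)

  dot-++ : ∀ {m n} (c₁ x₁ : Vec Carrier m) (c₂ x₂ : Vec Carrier n) →
           dot (c₁ ++ c₂) (x₁ ++ x₂) ≡ dot c₁ x₁ +ᴸ dot c₂ x₂
  dot-++ []       []       c₂ x₂ = sym (R.+-identityˡ _)
  dot-++ (c ∷ c₁) (x ∷ x₁) c₂ x₂ = trans (cong (x *ᴸ c +ᴸ_) (dot-++ c₁ x₁ c₂ x₂)) (sym (R.+-assoc _ _ _))

  infix 4 _⊥_
  _⊥_ : ∀ {n r} → Vec Carrier n → Vec (Vec Carrier n) r → Set
  c ⊥ xs = All (λ x → dot c x ≡ 0#) xs

  dot-lincomb : ∀ {n r} (c : Vec Carrier n) {xs : Vec (Vec Carrier n) r} (ks : Vec Carrier r) →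
                c ⊥ xs → dot c (lincomb ks xs) ≡ 0#
  dot-lincomb c []       []        = trans (dot-comm c zeroV) (dot-zeroˡ c)
  dot-lincomb c {x ∷ xs} (k ∷ ks) (c⊥x ∷ c⊥xs) = begin
    dot c ((k · x) ⊕ lincomb ks xs)          ≡⟨ dot-comm c _ ⟩
    dot ((k · x) ⊕ lincomb ks xs) c          ≡⟨ dot-⊕ˡ (k · x) _ c ⟩
    dot (k · x) c +ᴸ dot (lincomb ks xs) c   ≡⟨ cong₂ _+ᴸ_ (dot-·ˡ k x c) (dot-comm _ c) ⟩
    (k *ᴸ dot x c) +ᴸ dot c (lincomb ks xs)  ≡⟨ cong₂ _+ᴸ_ (cong (k *ᴸ_) (trans (dot-comm x c) c⊥x)) (dot-lincomb c ks c⊥xs) ⟩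
    (k *ᴸ 0#) +ᴸ 0#                          ≡⟨ R.+-identityʳ _ ⟩
    k *ᴸ 0#                                  ≡⟨ R.zeroʳ k ⟩
    0#                                       ∎
    where open ≡-Reasoning

  take-lincomb : ∀ m {n r} (ks : Vec Carrier r) (xs : Vec (Vec Carrier (m + n)) r) →
                 take m (lincomb ks xs) ≡ lincomb ks (Vec.map (take m) xs)
  take-lincomb m []       []       = take-replicate m
    where
    take-replicate : ∀ m {n} → take m (zeroV {m + n}) ≡ zeroV
    take-replicate zero    = refl
    take-replicate (suc m) = cong (0# ∷_) (take-replicate m)
  take-lincomb m (k ∷ ks) (x ∷ xs) =
    trans (Vec.take-zipWith {m = m} _+ᴸ_ (k · x) _) (cong₂ _⊕_ (Vec.take-map (k *ᴸ_) m x) (take-lincomb m ks xs))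

  drop-lincomb : ∀ m {n r} (ks : Vec Carrier r) (xs : Vec (Vec Carrier (m + n)) r) →
                 drop m (lincomb ks xs) ≡ lincomb ks (Vec.map (drop m) xs)
  drop-lincomb m []       []       = drop-replicate m
    where
    drop-replicate : ∀ m {n} → drop m (zeroV {m + n}) ≡ zeroV
    drop-replicate zero    = refl
    drop-replicate (suc m) = drop-replicate m
  drop-lincomb m (k ∷ ks) (x ∷ xs) =
    trans (Vec.drop-zipWith {m = m} _+ᴸ_ (k · x) _) (cong₂ _⊕_ (Vec.drop-map (k *ᴸ_) m x) (drop-lincomb m ks xs))

  -- Both bounds come from translating a fibre by one of its points.
  module _ {n : ℕ} {B : Set} (_≟_ : DecidableEquality B) (φ : Vec Carrier n → B)
           {P Z : Vec Carrier n → Set} (e : Enumeration P) (z : Enumeration Z) where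

    fibre≤kernel : (∀ {u v} → P u → P v → φ u ≡ φ v → Z (u ⊖ v)) →
                   ∀ y → size (restrict e (λ x → φ x ≟ y)) ≤ size z
    fibre≤kernel diff y = bound (restrict e (λ x → φ x ≟ y))
      where
      bound : (f : Enumeration (λ x → P x × φ x ≡ y)) → size f ≤ size z
      bound f with elems f in eq
      ... | []     = z≤n
      ... | w ∷ ws = subst (λ xs → length xs ≤ size z) eq (size-injection f z (_⊖ w)
            (λ (pu , φu) → diff pu (proj₁ fw) (trans φu (sym (proj₂ fw)))) (λ _ _ → ⊖-cancelʳ w))
        where
        fw : P w × φ w ≡ y
        fw = sound f (subst (w ∈_) (sym eq) (here refl))

    kernel≤fibre : ∀ {y} w → (∀ {v} → Z v → P (v ⊕ w) × φ (v ⊕ w) ≡ y) →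
                   size z ≤ size (restrict e (λ x → φ x ≟ y))
    kernel≤fibre w add = size-injection z (restrict e _) (_⊕ w) add (λ _ _ → ⊕-cancelʳ w)

-- Spans, bases and ranks over a subfield

module Span (L : Field) (S : Subfield L) where
  open Field L hiding (_+_; _*_)
  open Field L using () renaming (_*_ to _*ᴸ_)
  open Subfield S
  open LinAlg L
  open Vectors L

  in-zeroV : ∀ {n} → All In (zeroV {n})
  in-zeroV {zero}  = []
  in-zeroV {suc n} = in-0 ∷ in-zeroV

  in-⊕ : ∀ {n} {u v : Vec Carrier n} → All In u → All In v → All In (u ⊕ v)
  in-⊕ []       []       = []
  in-⊕ (x ∷ xs) (y ∷ ys) = in-+ x y ∷ in-⊕ xs ys

  in-· : ∀ {c n} {v : Vec Carrier n} → In c → All In v → All In (c · v)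
  in-· c []       = []
  in-· c (x ∷ xs) = in-* c x ∷ in-· c xs

  in-⊖ : ∀ {n} {u v : Vec Carrier n} → All In u → All In v → All In (u ⊖ v)
  in-⊖ u v = in-⊕ u (in-· (in-- in-1) v)

  in-lincomb : ∀ {n r} {ks : Vec Carrier r} {xs : Vec (Vec Carrier n) r} →
               All In ks → All (All In) xs → All In (lincomb ks xs)
  in-lincomb []       []       = in-zeroV
  in-lincomb (k ∷ ks) (x ∷ xs) = in-⊕ (in-· k x) (in-lincomb ks xs)

  lincomb-injective : ∀ {n r} {b : Vec (Vec Carrier n) r} → Independent In b →
    ∀ {cs ds} → All In cs → All In ds → lincomb cs b ≡ lincomb ds b → cs ≡ ds
  lincomb-injective {b = b} ind {cs} {ds} cs∈ ds∈ eq = ⊖≡0⇒≡ (ind (cs ⊖ ds) (in-⊖ cs∈ ds∈) (begin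
    lincomb (cs ⊖ ds) b              ≡⟨ lincomb-⊖ cs ds b ⟩
    lincomb cs b ⊖ lincomb ds b      ≡⟨ cong (_⊖ lincomb ds b) eq ⟩
    lincomb ds b ⊖ lincomb ds b      ≡⟨ ⊖-inverse _ ⟩
    zeroV                            ∎))
    where open ≡-Reasoning

  module _ {n r} {xs : Vec (Vec Carrier n) r} where

    span-zero : InSpan In xs zeroV
    span-zero = zeroV , in-zeroV , lincomb-zero xs

    span-⊕ : ∀ {u v} → InSpan In xs u → InSpan In xs v → InSpan In xs (u ⊕ v)
    span-⊕ (cs , cs∈ , refl) (ds , ds∈ , refl) = cs ⊕ ds , in-⊕ cs∈ ds∈ , lincomb-⊕ cs ds xs

    span-· : ∀ {c v} → In c → InSpan In xs v → InSpan In xs (c · v)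
    span-· {c} c∈ (cs , cs∈ , refl) = c · cs , in-· c∈ cs∈ , lincomb-· c cs xs

    span-lincomb : ∀ {s} {vs : Vec (Vec Carrier n) s} {cs} → All In cs → All (InSpan In xs) vs →
                   InSpan In xs (lincomb cs vs)
    span-lincomb []         []         = span-zero
    span-lincomb (c∈ ∷ cs∈) (v∈ ∷ vs∈) = span-⊕ (span-· c∈ v∈) (span-lincomb cs∈ vs∈)

    span-weaken : ∀ {x v} → InSpan In xs v → InSpan In (x ∷ xs) v
    span-weaken {x} (cs , cs∈ , refl) = 0# ∷ cs , in-0 ∷ cs∈ ,
      trans (cong (_⊕ lincomb cs xs) (·-zeroˡ x)) (⊕-identityˡ _)

    span-head : ∀ {x} → InSpan In (x ∷ xs) x
    span-head {x} = 1# ∷ zeroV , in-1 ∷ in-zeroV ,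
      trans (cong₂ _⊕_ (·-identity x) (lincomb-zero xs)) (⊕-identityʳ x)

  module _ (eS : Enumeration In) where

    -- Coordinates in a basis list a space that is given only as a predicate. This is applied to `L`
    -- over the subfield, to codes over `L`, and to spans over the subfield.
    enumerate : ∀ {n d} {W : Vec Carrier n → Set} (h : HasDim In W d) →
                (∀ {cs} → All In cs → W (lincomb cs (proj₁ h))) → Enumeration W
    enumerate {d = d} (b , b∈ , ind , spans) closed = image (vectorsOf eS d) (λ cs → lincomb cs b)
      closed (lincomb-injective ind) (λ {v} w → spans v w)

    size-enumerate : ∀ {n d} {W : Vec Carrier n → Set} (h : HasDim In W d)
                     (closed : ∀ {cs} → All In cs → W (lincomb cs (proj₁ h))) →
                     size (enumerate h closed) ≡ size eS ^ d
    size-enumerate {d = d} h closed =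
      trans (List.length-map (λ cs → lincomb cs (proj₁ h)) (vectors (elems eS) d)) (length-vectors (elems eS) d)

  module Rank (_≟_ : DecidableEquality Carrier) (eS : Enumeration In) where

    _≟ⱽ_ : ∀ {n} → DecidableEquality (Vec Carrier n)
    _≟ⱽ_ = Vec.≡-dec _≟_

    span? : ∀ {n r} (xs : Vec (Vec Carrier n) r) → Decidable (InSpan In xs)
    span? {r = r} xs v with Any.any? (λ cs → lincomb cs xs ≟ⱽ v) (elems (vectorsOf eS r))
    ... | yes any = let cs , cs∈ , eq = find any in yes (cs , sound (vectorsOf eS r) cs∈ , eq)
    ... | no ¬any = no λ (cs , cs∈ , eq) → ¬any (lose (complete (vectorsOf eS r) cs∈) eq)

    independent-∷ : ∀ {n r} {x : Vec Carrier n} {b : Vec (Vec Carrier n) r} →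
                    ¬ InSpan In b x → Independent In b → Independent In (x ∷ b)
    independent-∷ {x = x} {b} x∉ ind (c ∷ cs) (c∈ ∷ cs∈) eq with c ≟ 0#
    ... | yes refl = cong (0# ∷_) (ind cs cs∈
            (trans (sym (trans (cong (_⊕ lincomb cs b) (·-zeroˡ x)) (⊕-identityˡ _))) eq))
    -- A nonzero leading coefficient has its inverse in the subfield, so the relation can be solved
    -- for `x` within the allowed scalars.
    ... | no c≢0 = contradiction (subst (InSpan In b) x≡ (span-· (in-inv c∈ cd≡1)
                     (span-· (in-- in-1) (cs , cs∈ , refl)))) x∉
      where
      open ≡-Reasoning
      d = proj₁ (inverse c c≢0)
      cd≡1 : c *ᴸ d ≡ 1#
      cd≡1 = proj₂ (inverse c c≢0)
      -Σ≡cx : (- 1#) · lincomb cs b ≡ c · x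
      -Σ≡cx = ⊕-cancelʳ (lincomb cs b) (begin
        ((- 1#) · lincomb cs b) ⊕ lincomb cs b  ≡⟨ ⊕-comm _ _ ⟩
        lincomb cs b ⊖ lincomb cs b             ≡⟨ ⊖-inverse _ ⟩
        zeroV                                   ≡⟨ eq ⟨
        (c · x) ⊕ lincomb cs b                  ∎)
      x≡ : d · ((- 1#) · lincomb cs b) ≡ x
      x≡ = begin
        d · ((- 1#) · lincomb cs b)  ≡⟨ cong (d ·_) -Σ≡cx ⟩
        d · (c · x)                  ≡⟨ ·-assoc d c x ⟨
        (d *ᴸ c) · x                 ≡⟨ cong (_· x) (trans (R.*-comm d c) cd≡1) ⟩
        1# · x                       ≡⟨ ·-identity x ⟩
        x                            ∎

    SpanBasis : ∀ {n r} → Vec (Vec Carrier n) r → Set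
    SpanBasis xs = Σ ℕ (HasDim In (InSpan In xs))

    -- The decision is an argument so that `rank (x ∷ xs)` computes to `rank xs` or its successor
    -- once `span? xs x` is known. The basis is greedy: a vector is kept exactly when the vectors
    -- behind it do not span it.
    extend : ∀ {n r} {x : Vec Carrier n} {xs : Vec (Vec Carrier n) r} →
             Dec (InSpan In xs x) → SpanBasis xs → SpanBasis (x ∷ xs)
    extend {x = x} {xs} (yes x∈) (d , b , b∈ , ind , spans) =
      d , b , VecAll.map span-weaken b∈ , ind ,
      λ { v (c ∷ cs , c∈ ∷ cs∈ , refl) → spans v (span-⊕ (span-· c∈ x∈) (cs , cs∈ , refl)) }
    extend {x = x} {xs} (no x∉) (d , b , b∈ , ind , spans) =
      suc d , x ∷ b , span-head ∷ VecAll.map span-weaken b∈ ,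
      independent-∷ (λ { (cs , cs∈ , eq) → x∉ (subst (InSpan In xs) eq (span-lincomb cs∈ b∈)) }) ind ,
      λ { v (c ∷ cs , c∈ ∷ cs∈ , refl) →
          let ds , ds∈ , eq = spans _ (cs , cs∈ , refl)
          in c ∷ ds , c∈ ∷ ds∈ , cong ((c · x) ⊕_) eq }

    spanBasis : ∀ {n r} (xs : Vec (Vec Carrier n) r) → SpanBasis xs
    spanBasis []       = 0 , [] , [] , (λ { [] _ _ → refl }) , λ v v∈ → v∈
    spanBasis (x ∷ xs) = extend (span? xs x) (spanBasis xs)

    rank : ∀ {n r} → Vec (Vec Carrier n) r → ℕ
    rank xs = proj₁ (spanBasis xs)

    basis-closed : ∀ {n r} (xs : Vec (Vec Carrier n) r) {cs} → All In cs →
                   InSpan In xs (lincomb cs (proj₁ (proj₂ (spanBasis xs))))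
    basis-closed xs cs∈ = span-lincomb cs∈ (proj₁ (proj₂ (proj₂ (spanBasis xs))))

    spanEnumeration : ∀ {n r} (xs : Vec (Vec Carrier n) r) → Enumeration (InSpan In xs)
    spanEnumeration xs = enumerate eS (proj₂ (spanBasis xs)) (basis-closed xs)

    size-span : ∀ {n r} (xs : Vec (Vec Carrier n) r) → size (spanEnumeration xs) ≡ size eS ^ rank xs
    size-span xs = size-enumerate eS (proj₂ (spanBasis xs)) (basis-closed xs)

    rank-∈ : ∀ {n r} {x : Vec Carrier n} (xs : Vec (Vec Carrier n) r) → InSpan In xs x →
             rank (x ∷ xs) ≡ rank xs
    rank-∈ {x = x} xs x∈ with span? xs x
    ... | yes _ = refl
    ... | no x∉ = contradiction x∈ x∉

    rank-∉ : ∀ {n r} {x : Vec Carrier n} (xs : Vec (Vec Carrier n) r) → ¬ InSpan In xs x →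
             rank (x ∷ xs) ≡ suc (rank xs)
    rank-∉ {x = x} xs x∉ with span? xs x
    ... | yes x∈ = contradiction x∈ x∉
    ... | no _   = refl

    rank-∷-≥ : ∀ {n r} (x : Vec Carrier n) (xs : Vec (Vec Carrier n) r) → rank xs ≤ rank (x ∷ xs)
    rank-∷-≥ x xs with span? xs x
    ... | yes _ = ≤-refl
    ... | no _  = n≤1+n _

    -- Counting replaces basis extension: the span has `size eS ^ rank xs` elements, strictly fewer
    -- than the whole space because the subfield has at least two.
    rank<⇒escapes : ∀ {n r} (xs : Vec (Vec Carrier n) r) → 2 ≤ size eS → rank xs < n →
                    ∃ λ x → All In x × ¬ InSpan In xs x
    rank<⇒escapes {n} xs 2≤s lt = escapes (spanEnumeration xs) (vectorsOf eS n) (span? xs)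
      (subst₂ _<_ (sym (size-span xs)) (sym (length-vectors (elems eS) n)) (^-monoʳ-< (size eS) 2≤s lt))

-- Sizes in a finite field extension

^-cancelʳ-≤ : ∀ q {a b} → 2 ≤ q → q ^ a ≤ q ^ b → a ≤ b
^-cancelʳ-≤ q {a} {b} 2≤q le with a ≤? b
... | yes a≤b = a≤b
... | no a≰b  = contradiction le (<⇒≱ (^-monoʳ-< q 2≤q (≰⇒> a≰b)))

-- In a duplicate-free list two entries are equal exactly when their positions are, and positions
-- can be compared.
∈-unique-≟ : {A : Set} {xs : List A} → Unique xs → ∀ {x y} → x ∈ xs → y ∈ xs → Dec (x ≡ y)
∈-unique-≟ _        (here refl) (here refl) = yes refl
∈-unique-≟ (x∉ ∷ _) (here refl) (there y∈)  = no (ListAll.lookup x∉ y∈)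
∈-unique-≟ (y∉ ∷ _) (there x∈)  (here refl) = no (ListAll.lookup y∉ x∈ ∘ sym)
∈-unique-≟ (_ ∷ u)  (there x∈)  (there y∈)  = ∈-unique-≟ u x∈ y∈

All-≟ : {A : Set} {P : A → Set} → (∀ {x y} → P x → P y → Dec (x ≡ y)) →
        ∀ {n} {u v : Vec A n} → All P u → All P v → Dec (u ≡ v)
All-≟ _≟_ []       []       = yes refl
All-≟ _≟_ (p ∷ ps) (q ∷ qs) with p ≟ q | All-≟ _≟_ ps qs
... | yes refl | yes refl = yes refl
... | no x≢y   | _        = no (x≢y ∘ Vec.∷-injectiveˡ)
... | _        | no u≢v   = no (u≢v ∘ Vec.∷-injectiveʳ)

module FiniteExtension {q m : ℕ} (E : Extension q m) where
  open Extension E hiding (_+_; _*_)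
  open Extension E using () renaming (_+_ to _+ᴸ_)
  open Codes E
  open Vectors L

  whole : Subfield L
  whole = record { In = Everything }

  eK : Enumeration In
  eK = record
    { elems    = K-elems
    ; unique   = K-unique
    ; sound    = ListAll.lookup K-sound
    ; complete = λ {x} → K-complete x
    }

  module SpanK = Span L K
  module SpanL = Span L whole

  Q : ℕ
  Q = q ^ m

  infix 4 _≟_
  -- Equality in `L` is inherited from the finite subfield by comparing coordinates in the basis
  -- supplied by `degree`.
  _≟_ : DecidableEquality Carrier
  x ≟ y with degree
  ... | b , _ , ind , spans with spans (x ∷ []) tt | spans (y ∷ []) tt
  ... | cs , cs∈ , eq | ds , ds∈ , eq′
    with All-≟ (λ p p′ → ∈-unique-≟ K-unique (K-complete _ p) (K-complete _ p′)) cs∈ ds∈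
  ... | yes refl = yes (Vec.∷-injectiveˡ (trans (sym eq) eq′))
  ... | no cs≢ds = no λ { refl → cs≢ds (SpanK.lincomb-injective ind cs∈ ds∈ (trans eq (sym eq′))) }

  open SpanK.Rank _≟_ eK

  eL : Enumeration Everything
  eL = image (SpanK.enumerate eK degree (λ _ → tt)) Vec.head (λ _ → tt)
    (λ { {x ∷ []} {y ∷ []} _ _ refl → refl }) (λ {y} _ → y ∷ [] , tt , refl)

  size-eL : size eL ≡ Q
  size-eL = begin
    size eL                                       ≡⟨ List.length-map Vec.head (elems (SpanK.enumerate eK degree (λ _ → tt))) ⟩
    size (SpanK.enumerate eK degree (λ _ → tt))   ≡⟨ SpanK.size-enumerate eK degree (λ _ → tt) ⟩
    length K-elems ^ m                            ≡⟨ cong (_^ m) K-card ⟩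
    q ^ m                                         ∎
    where open ≡-Reasoning

  2≤q : 2 ≤ q
  2≤q = subst (2 ≤_) K-card (Unique-⊆⇒length≤ {xs = 0# ∷ 1# ∷ []}
    ((0≢1 ListAll.∷ ListAll.[]) ∷ ListAll.[] ∷ [])
    λ { (here refl) → K-complete 0# (Subfield.in-0 K) ; (there (here refl)) → K-complete 1# (Subfield.in-1 K) })

  instance
    q-nonZero : NonZero q
    q-nonZero = >-nonZero (≤-trans (s≤s z≤n) 2≤q)

    Q-nonZero : NonZero Q
    Q-nonZero = m^n≢0 q m

  Kvectors : ∀ n → Enumeration (All In {n})
  Kvectors = vectorsOf eK

  size-Kvectors : ∀ n → size (Kvectors n) ≡ q ^ n
  size-Kvectors n = trans (length-vectors K-elems n) (cong (_^ n) K-card)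

  size-spanK : ∀ {n r} (xs : Vec (Vec Carrier n) r) → size (spanEnumeration xs) ≡ q ^ rank xs
  size-spanK xs = trans (size-span xs) (cong (_^ rank xs) K-card)

  kernel : ∀ {n} (c : Vec Carrier n) → Enumeration (λ x → All In x × dot c x ≡ 0#)
  kernel c = restrict (Kvectors _) (λ x → dot c x ≟ 0#)

  -- Pairing with `c` maps Kⁿ onto the span of the entries of `c`, which has `q ^ r` elements, and
  -- every fibre is a translate of the kernel.
  rank-nullity : ∀ {n r} {c : Vec Carrier n} → RankWeight c r → size (kernel c) * q ^ r ≡ q ^ n
  rank-nullity {n} {r} {c} h@(b , b∈ , _) = sym (begin
    q ^ n                                                          ≡⟨ size-Kvectors n ⟨
    size (Kvectors n)                                              ≡⟨ size-fibres _≟ⱽ_ (Kvectors n) eW φ (λ {x} x∈ → x , x∈ , lincomb-singletons x c) ⟩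
    sumOver (elems eW) (λ y → size (restrict (Kvectors n) (λ x → φ x ≟ⱽ y)))
      ≡⟨ sumOver-cong (elems eW) (λ y∈ → fibre≡kernel (sound eW y∈)) ⟩
    sumOver (elems eW) (λ _ → size (kernel c))                     ≡⟨ sumOver-const (elems eW) _ ⟩
    size eW * size (kernel c)                                      ≡⟨ *-comm (size eW) _ ⟩
    size (kernel c) * size eW                                      ≡⟨ cong (size (kernel c) *_) (trans (SpanK.size-enumerate eK h closed) (cong (_^ r) K-card)) ⟩
    size (kernel c) * q ^ r                                        ∎)
    where
    open ≡-Reasoning
    W = InSpan In (Vec.map Vec.[_] c)
    closed : ∀ {cs} → All In cs → W (lincomb cs b)
    closed cs∈ = SpanK.span-lincomb cs∈ b∈
    eW : Enumeration W
    eW = SpanK.enumerate eK h closed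
    φ : Vec Carrier n → Vec Carrier 1
    φ x = dot c x ∷ []
    fibre≡kernel : ∀ {y} → W y → size (restrict (Kvectors n) (λ x → φ x ≟ⱽ y)) ≡ size (kernel c)
    fibre≡kernel (w , w∈ , refl) = ≤-antisym
      (fibre≤kernel _≟ⱽ_ φ (Kvectors n) (kernel c)
        (λ {u} {v} u∈ v∈ eq → SpanK.in-⊖ u∈ v∈ ,
          trans (dot-comm c _) (dot-⊖ˡ u v c (trans (dot-comm u c) (trans (Vec.∷-injectiveˡ eq) (dot-comm c v))))) _)
      (kernel≤fibre _≟ⱽ_ φ (Kvectors n) (kernel c) w
        (λ {v} (v∈ , cv≡0) → SpanK.in-⊕ v∈ w∈ , trans (cong (_∷ []) (begin
          dot c (v ⊕ w)            ≡⟨ dot-comm c _ ⟩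
          dot (v ⊕ w) c            ≡⟨ dot-⊕ˡ v w c ⟩
          dot v c +ᴸ dot w c       ≡⟨ cong₂ _+ᴸ_ (trans (dot-comm v c) cv≡0) (dot-comm w c) ⟩
          0# +ᴸ dot c w            ≡⟨ R.+-identityˡ _ ⟩
          dot c w                  ∎)) (sym (lincomb-singletons w c))))

  rankWeight : ∀ {n} (c : Vec Carrier n) → ∃ (RankWeight c)
  rankWeight c = spanBasis (Vec.map Vec.[_] c)

  -- The span of `xs` lies in the kernel of `c`; comparing the two sizes bounds the exponents.
  rank+weight≤ : ∀ {n r s} {c : Vec Carrier n} {xs : Vec (Vec Carrier n) r} →
                 All (All In) xs → c ⊥ xs → RankWeight c s → rank xs + s ≤ n
  rank+weight≤ {n} {s = s} {c} {xs} xs∈ c⊥xs h = ^-cancelʳ-≤ q 2≤q (begin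
    q ^ (rank xs + s)                    ≡⟨ ^-distribˡ-+-* q (rank xs) s ⟩
    q ^ rank xs * q ^ s                  ≡⟨ cong (_* q ^ s) (size-spanK xs) ⟨
    size (spanEnumeration xs) * q ^ s    ≤⟨ *-monoˡ-≤ (q ^ s) (size-mono (spanEnumeration xs) (kernel c)
      (λ { (ks , ks∈ , refl) → SpanK.in-lincomb ks∈ xs∈ , dot-lincomb c ks c⊥xs })) ⟩
    size (kernel c) * q ^ s              ≡⟨ rank-nullity h ⟩
    q ^ n                                ∎)
    where open ≤-Reasoning

  _⊥?_ : ∀ {n r} (c : Vec Carrier n) (xs : Vec (Vec Carrier n) r) → Dec (c ⊥ xs)
  c ⊥? xs = all? (λ x → dot c x ≟ 0#) xs

  indicator-⊥-∷ : ∀ {n r} (c x : Vec Carrier n) (xs : Vec (Vec Carrier n) r) →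
    indicator (c ⊥? (x ∷ xs)) ≡ indicator (dot c x ≟ 0#) * indicator (c ⊥? xs)
  indicator-⊥-∷ c x xs with dot c x ≟ 0# | c ⊥? xs
  ... | yes _ | yes _ = refl
  ... | yes _ | no _  = refl
  ... | no _  | yes _ = refl
  ... | no _  | no _  = refl

  -- Codewords orthogonal to a tuple, and their moments

  module Annihilators {n k : ℕ} {C : Vec Carrier n → Set} (code : LinearCode n k C) where
    open LinearCode code

    code-lincomb : ∀ {r} (cs : Vec Carrier r) {vs : Vec (Vec Carrier n) r} → All C vs → C (lincomb cs vs)
    code-lincomb []       []       = has-0
    code-lincomb (c ∷ cs) (v ∷ vs) = has-+ (has-· c v) (code-lincomb cs vs)

    codewords : Enumeration C
    codewords = SpanL.enumerate eL dim (λ {cs} _ → code-lincomb cs (proj₁ (proj₂ dim)))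

    size-codewords : size codewords ≡ Q ^ k
    size-codewords = trans (SpanL.size-enumerate eL dim (λ {cs} _ → code-lincomb cs (proj₁ (proj₂ dim)))) (cong (_^ k) size-eL)

    annihilators : ∀ {r} (xs : Vec (Vec Carrier n) r) → Enumeration (λ c → C c × c ⊥ xs)
    annihilators xs = restrict codewords (_⊥? xs)

    zero-annihilates : ∀ {r} (xs : Vec (Vec Carrier n) r) → zeroV ⊥ xs
    zero-annihilates xs = VecAll.universal dot-zeroˡ xs

    -- Pairing with `x` takes at most `Q` values on the annihilators of `xs`, and each fibre embeds
    -- into the annihilators of `x ∷ xs` by a translation.
    annihilators-cut : ∀ {r} (x : Vec Carrier n) (xs : Vec (Vec Carrier n) r) →
                       size (annihilators xs) ≤ Q * size (annihilators (x ∷ xs))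
    annihilators-cut x xs = begin
      size (annihilators xs)
        ≡⟨ size-fibres _≟_ (annihilators xs) eL φ (λ _ → tt) ⟩
      sumOver (elems eL) (λ y → size (restrict (annihilators xs) (λ c → φ c ≟ y)))
        ≤⟨ sumOver-mono (elems eL) (λ {y} _ → fibre≤kernel _≟_ φ (annihilators xs) (annihilators (x ∷ xs)) difference y) ⟩
      sumOver (elems eL) (λ _ → size (annihilators (x ∷ xs)))
        ≡⟨ sumOver-const (elems eL) _ ⟩
      size eL * size (annihilators (x ∷ xs))
        ≡⟨ cong (_* size (annihilators (x ∷ xs))) size-eL ⟩
      Q * size (annihilators (x ∷ xs))
        ∎
      where
      open ≤-Reasoning
      φ : Vec Carrier n → Carrier
      φ c = dot c x
      ⊖-⊥ : ∀ u v {r} {xs : Vec (Vec Carrier n) r} → u ⊥ xs → v ⊥ xs → (u ⊖ v) ⊥ xs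
      ⊖-⊥ u v []       []       = []
      ⊖-⊥ u v {xs = x ∷ _} (p ∷ ps) (q ∷ qs) = dot-⊖ˡ u v x (trans p (sym q)) ∷ ⊖-⊥ u v ps qs
      difference : ∀ {u v} → C u × u ⊥ xs → C v × v ⊥ xs → φ u ≡ φ v → C (u ⊖ v) × (u ⊖ v) ⊥ (x ∷ xs)
      difference {u} {v} (cu , u⊥) (cv , v⊥) eq =
        has-+ cu (has-· (- 1#) cv) , dot-⊖ˡ u v x eq ∷ ⊖-⊥ u v u⊥ v⊥

    annihilators-lower : ∀ {r} (xs : Vec (Vec Carrier n) r) → Q ^ (k ∸ rank xs) ≤ size (annihilators xs)
    annihilators-lower []       =
      ≤-trans (≤-reflexive (sym size-codewords)) (size-mono codewords (annihilators []) (λ c → c , []))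
    annihilators-lower (x ∷ xs) = step (span? xs x)
      where
      open ≤-Reasoning
      decrease : ∀ j → Q ^ j ≤ size (annihilators xs) → Q ^ (j ∸ 1) ≤ size (annihilators (x ∷ xs))
      -- Here the exponent stays at 0 by truncation, and the zero codeword alone meets the bound.
      decrease zero    le = size-inhabited (annihilators (x ∷ xs)) (has-0 , zero-annihilates (x ∷ xs))
      decrease (suc j) le = *-cancelˡ-≤ Q (≤-trans le (annihilators-cut x xs))
      step : Dec (InSpan In xs x) → Q ^ (k ∸ rank (x ∷ xs)) ≤ size (annihilators (x ∷ xs))
      -- An equation that depends on the earlier ones holds automatically, so neither the rank nor
      -- the set of annihilators changes.
      step (yes x∈@(ks , ks∈ , refl)) = begin
        Q ^ (k ∸ rank (x ∷ xs))        ≡⟨ cong (λ r → Q ^ (k ∸ r)) (rank-∈ xs x∈) ⟩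
        Q ^ (k ∸ rank xs)              ≤⟨ annihilators-lower xs ⟩
        size (annihilators xs)         ≤⟨ size-mono (annihilators xs) (annihilators (x ∷ xs))
                                            (λ {c} (cc , c⊥) → cc , dot-lincomb c ks c⊥ ∷ c⊥) ⟩
        size (annihilators (x ∷ xs))   ∎
      step (no x∉) = begin
        Q ^ (k ∸ rank (x ∷ xs))        ≡⟨ cong (λ r → Q ^ (k ∸ r)) (trans (rank-∉ xs x∉) (+-comm 1 _)) ⟩
        Q ^ (k ∸ (rank xs + 1))        ≡⟨ cong (Q ^_) (∸-+-assoc k (rank xs) 1) ⟨
        Q ^ (k ∸ rank xs ∸ 1)          ≤⟨ decrease (k ∸ rank xs) (annihilators-lower xs) ⟩
        size (annihilators (x ∷ xs))   ∎

    -- The tuple `xs` is the part already chosen, with `t` vectors still to be summed over; the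
    -- `t`-th moment is the case of the empty tuple.
    tupleSum : ℕ → ∀ {r} → Vec (Vec Carrier n) r → ℕ
    tupleSum zero    xs = size (annihilators xs)
    tupleSum (suc t) xs = sumOver (elems (Kvectors n)) (λ x → tupleSum t (x ∷ xs))

    -- Double counting of the pairs (codeword, t-tuple in its kernel).
    tupleSum≡moment : ∀ t {r} (xs : Vec (Vec Carrier n) r) →
      tupleSum t xs ≡ sumOver (elems codewords) (λ c → indicator (c ⊥? xs) * size (kernel c) ^ t)
    tupleSum≡moment zero xs = trans (length-filter (_⊥? xs) (elems codewords))
      (sumOver-cong (elems codewords) (λ {c} _ → sym (*-identityʳ (indicator (c ⊥? xs)))))
    tupleSum≡moment (suc t) xs = begin
      sumOver Ks (λ x → tupleSum t (x ∷ xs))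
        ≡⟨ sumOver-cong Ks (λ {x} _ → tupleSum≡moment t (x ∷ xs)) ⟩
      sumOver Ks (λ x → sumOver Cs (λ c → indicator (c ⊥? (x ∷ xs)) * size (kernel c) ^ t))
        ≡⟨ sumOver-swap Ks Cs _ ⟩
      sumOver Cs (λ c → sumOver Ks (λ x → indicator (c ⊥? (x ∷ xs)) * size (kernel c) ^ t))
        ≡⟨ sumOver-cong Cs (λ {c} _ → inner c) ⟩
      sumOver Cs (λ c → indicator (c ⊥? xs) * size (kernel c) ^ suc t)
        ∎
      where
      open ≡-Reasoning
      Ks = elems (Kvectors n)
      Cs = elems codewords
      inner : ∀ c → sumOver Ks (λ x → indicator (c ⊥? (x ∷ xs)) * size (kernel c) ^ t)
                    ≡ indicator (c ⊥? xs) * size (kernel c) ^ suc t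
      inner c = begin
        sumOver Ks (λ x → indicator (c ⊥? (x ∷ xs)) * κ ^ t)
          ≡⟨ sumOver-cong Ks (λ {x} _ → trans (cong (_* κ ^ t) (indicator-⊥-∷ c x xs)) (*-assoc (indicator (dot c x ≟ 0#)) δ (κ ^ t))) ⟩
        sumOver Ks (λ x → indicator (dot c x ≟ 0#) * (δ * κ ^ t))
          ≡⟨ sumOver-*ʳ Ks (λ x → indicator (dot c x ≟ 0#)) (δ * κ ^ t) ⟩
        sumOver Ks (λ x → indicator (dot c x ≟ 0#)) * (δ * κ ^ t)
          ≡⟨ cong (_* (δ * κ ^ t)) (length-filter (λ x → dot c x ≟ 0#) Ks) ⟨
        κ * (δ * κ ^ t)
          ≡⟨ *-assoc κ δ (κ ^ t) ⟨
        κ * δ * κ ^ t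
          ≡⟨ cong (_* κ ^ t) (*-comm κ δ) ⟩
        δ * κ * κ ^ t
          ≡⟨ *-assoc δ κ (κ ^ t) ⟩
        δ * κ ^ suc t
          ∎
        where
        κ = size (kernel c)
        δ = indicator (c ⊥? xs)

-- Annihilators in a sum of two MRD codes

module _ {A : Set} where

  take-++ : ∀ {m n} (u : Vec A m) (v : Vec A n) → take m (u ++ v) ≡ u
  take-++ []      v = refl
  take-++ (x ∷ u) v = cong (x ∷_) (take-++ u v)

  drop-++ : ∀ {m n} (u : Vec A m) (v : Vec A n) → drop m (u ++ v) ≡ v
  drop-++ []      v = refl
  drop-++ (x ∷ u) v = drop-++ u v

  All-++ : ∀ {P : A → Set} {m n} {u : Vec A m} {v : Vec A n} → All P u → All P v → All P (u ++ v)
  All-++ []       qs = qs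
  All-++ (p ∷ ps) qs = p ∷ All-++ ps qs

  All-take : ∀ {P : A → Set} m {n} {v : Vec A (m + n)} → All P v → All P (take m v)
  All-take zero    ps                = []
  All-take (suc m) {v = _ ∷ _} (p ∷ ps) = p ∷ All-take m ps

  All-drop : ∀ {P : A → Set} m {n} {v : Vec A (m + n)} → All P v → All P (drop m v)
  All-drop zero    ps                = ps
  All-drop (suc m) {v = _ ∷ _} (p ∷ ps) = All-drop m ps

  sumOver-take-drop : ∀ (xs : List A) m {n} (f : Vec A m → ℕ) (g : Vec A n → ℕ) →
    sumOver (vectors xs (m + n)) (λ x → f (take m x) * g (drop m x))
    ≡ sumOver (vectors xs m) f * sumOver (vectors xs n) g
  sumOver-take-drop xs m {n} f g = begin
    sumOver (vectors xs (m + n)) (λ x → f (take m x) * g (drop m x))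
      ≡⟨ sumOver-vectors-++ xs m _ ⟩
    sumOver (vectors xs m) (λ u → sumOver (vectors xs n) (λ v → f (take m (u ++ v)) * g (drop m (u ++ v))))
      ≡⟨ sumOver-cong (vectors xs m) (λ {u} _ → sumOver-cong (vectors xs n) (λ {v} _ →
           cong₂ (λ a b → f a * g b) (take-++ u v) (drop-++ u v))) ⟩
    sumOver (vectors xs m) (λ u → sumOver (vectors xs n) (λ v → f u * g v))
      ≡⟨ sumOver-cong (vectors xs m) (λ {u} _ → sumOver-*ˡ (vectors xs n) (f u) g) ⟩
    sumOver (vectors xs m) (λ u → f u * sumOver (vectors xs n) g)
      ≡⟨ sumOver-*ʳ (vectors xs m) f _ ⟩
    sumOver (vectors xs m) f * sumOver (vectors xs n) g
      ∎
    where open ≡-Reasoning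

-- The deficits of `C` and of its two subcodes supported on one block, which feel a tuple only
-- through its projection. Truncated subtraction supplies the 0 in the maximum.
exponent : (k₁ k₂ u a b : ℕ) → ℕ
exponent k₁ k₂ u a b = (k₁ + k₂ ∸ u) ⊔ ((k₁ ∸ a) ⊔ (k₂ ∸ b))

-- The recursion for the power sums

module _ (q m n₁ n₂ k₁ k₂ : ℕ) where

  -- The arguments u, a, b are the ranks of a tuple and of its two projections.
  -- The classes of vectors x extending the tuple are weighted by their sizes;
  -- the class "both projections of x in the span, but x not" appears as a difference.
  momentFrom : ℕ → ℕ → ℕ → ℕ → ℕ
  momentFrom zero    u a b = (q ^ m) ^ exponent k₁ k₂ u a b
  momentFrom (suc t) u a b =
    (q ^ u * g u a b
      + (q ^ a * q ^ b * g (suc u) a b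
      + (q ^ a * (q ^ n₂ ∸ q ^ b) * g (suc u) a (suc b)
      + ((q ^ n₁ ∸ q ^ a) * q ^ b * g (suc u) (suc a) b
      + (q ^ n₁ ∸ q ^ a) * (q ^ n₂ ∸ q ^ b) * g (suc u) (suc a) (suc b)))))
    ∸ q ^ u * g (suc u) a b
    where
    g = momentFrom t

module SumCode {q m n₁ n₂ k₁ k₂ : ℕ} (E : Extension q m) (k₁<n₁ : k₁ < n₁) (k₂<n₂ : k₂ < n₂)
               {C : Vec (Extension.Carrier E) (n₁ + n₂) → Set} (sumMRD : Codes.SumMRD E n₁ n₂ k₁ k₂ C) where
  open Extension E hiding (_+_; _*_)
  open Extension E using () renaming (_+_ to _+ᴸ_)
  open Codes E
  open SumMRD sumMRD
  open Vectors L
  open FiniteExtension E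
  open SpanK.Rank _≟_ eK
  open Annihilators code

  module Code₁ = Annihilators (proj₁ C₁-MRD)
  module Code₂ = Annihilators (proj₁ C₂-MRD)

  N : ℕ
  N = n₁ + n₂

  π₁ : ∀ {r} → Vec (Vec Carrier N) r → Vec (Vec Carrier n₁) r
  π₁ = Vec.map (take n₁)

  π₂ : ∀ {r} → Vec (Vec Carrier N) r → Vec (Vec Carrier n₂) r
  π₂ = Vec.map (drop n₁)

  in-π₁ : ∀ {r} {xs : Vec (Vec Carrier N) r} → All (All In) xs → All (All In) (π₁ xs)
  in-π₁ []         = []
  in-π₁ (x∈ ∷ xs∈) = All-take n₁ x∈ ∷ in-π₁ xs∈

  in-π₂ : ∀ {r} {xs : Vec (Vec Carrier N) r} → All (All In) xs → All (All In) (π₂ xs)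
  in-π₂ []         = []
  in-π₂ (x∈ ∷ xs∈) = All-drop n₁ x∈ ∷ in-π₂ xs∈

  span-π₁ : ∀ {r x} {xs : Vec (Vec Carrier N) r} → InSpan In xs x → InSpan In (π₁ xs) (take n₁ x)
  span-π₁ {xs = xs} (ks , ks∈ , refl) = ks , ks∈ , sym (take-lincomb n₁ ks xs)

  span-π₂ : ∀ {r x} {xs : Vec (Vec Carrier N) r} → InSpan In xs x → InSpan In (π₂ xs) (drop n₁ x)
  span-π₂ {xs = xs} (ks , ks∈ , refl) = ks , ks∈ , sym (drop-lincomb n₁ ks xs)

  dot-take-drop : ∀ c₁ c₂ (x : Vec Carrier N) → dot (c₁ ++ c₂) x ≡ dot c₁ (take n₁ x) +ᴸ dot c₂ (drop n₁ x)
  dot-take-drop c₁ c₂ x = trans (cong (dot (c₁ ++ c₂)) (sym (Vec.take++drop≡id n₁ x)))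
    (dot-++ c₁ (take n₁ x) c₂ (drop n₁ x))

  dot-zero₂ : ∀ c₁ (x : Vec Carrier N) → dot (c₁ ++ zeroV {n₂}) x ≡ dot c₁ (take n₁ x)
  dot-zero₂ c₁ x = trans (dot-take-drop c₁ zeroV x)
    (trans (cong (dot c₁ (take n₁ x) +ᴸ_) (dot-zeroˡ (drop n₁ x))) (R.+-identityʳ _))

  dot-zero₁ : ∀ c₂ (x : Vec Carrier N) → dot (zeroV {n₁} ++ c₂) x ≡ dot c₂ (drop n₁ x)
  dot-zero₁ c₂ x = trans (dot-take-drop zeroV c₂ x)
    (trans (cong (_+ᴸ dot c₂ (drop n₁ x)) (dot-zeroˡ (take n₁ x))) (R.+-identityˡ _))

  ⊥-π₁⁻ : ∀ c₁ {r} {xs : Vec (Vec Carrier N) r} → (c₁ ++ zeroV) ⊥ xs → c₁ ⊥ π₁ xs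
  ⊥-π₁⁻ c₁ []                 = []
  ⊥-π₁⁻ c₁ {xs = x ∷ _} (p ∷ ps) = trans (sym (dot-zero₂ c₁ x)) p ∷ ⊥-π₁⁻ c₁ ps

  ⊥-π₂⁻ : ∀ c₂ {r} {xs : Vec (Vec Carrier N) r} → (zeroV {n₁} ++ c₂) ⊥ xs → c₂ ⊥ π₂ xs
  ⊥-π₂⁻ c₂ []                 = []
  ⊥-π₂⁻ c₂ {xs = x ∷ _} (p ∷ ps) = trans (sym (dot-zero₁ c₂ x)) p ∷ ⊥-π₂⁻ c₂ ps

  ⊥-π₁⁺ : ∀ c₁ {r} {xs : Vec (Vec Carrier N) r} → c₁ ⊥ π₁ xs → (c₁ ++ zeroV) ⊥ xs
  ⊥-π₁⁺ c₁ {xs = []}    []       = []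
  ⊥-π₁⁺ c₁ {xs = x ∷ _} (p ∷ ps) = trans (dot-zero₂ c₁ x) p ∷ ⊥-π₁⁺ c₁ ps

  ⊥-π₂⁺ : ∀ c₂ {r} {xs : Vec (Vec Carrier N) r} → c₂ ⊥ π₂ xs → (zeroV {n₁} ++ c₂) ⊥ xs
  ⊥-π₂⁺ c₂ {xs = []}    []       = []
  ⊥-π₂⁺ c₂ {xs = x ∷ _} (p ∷ ps) = trans (dot-zero₁ c₂ x) p ∷ ⊥-π₂⁺ c₂ ps

  -- Rank and weight together are at most `n`, while the assumptions make them at least `n + 1`.
  -- Stated for any length, because it serves the whole tuple and both projections.
  heavy⇒¬⊥ : ∀ {n k r} {c : Vec Carrier n} {xs : Vec (Vec Carrier n) r} → All (All In) xs → k ≤ rank xs →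
             (∀ s → RankWeight c s → suc (n ∸ k) ≤ s) → ¬ (c ⊥ xs)
  heavy⇒¬⊥ {n} {k} {c = c} {xs} xs∈ k≤ heavy c⊥ = <-irrefl refl (begin-strict
    n                          ≤⟨ m≤n+m∸n n k ⟩
    k + (n ∸ k)                <⟨ n<1+n _ ⟩
    suc (k + (n ∸ k))          ≡⟨ +-suc k (n ∸ k) ⟨
    k + suc (n ∸ k)            ≤⟨ +-mono-≤ k≤ (heavy (proj₁ w) (proj₂ w)) ⟩
    rank xs + proj₁ w          ≤⟨ rank+weight≤ xs∈ c⊥ (proj₂ w) ⟩
    n                          ∎)
    where
    open ≤-Reasoning
    w = rankWeight c

  module _ {r} {xs : Vec (Vec Carrier N) r} (xs∈ : All (All In) xs)
           (K≤ : k₁ + k₂ ≤ rank xs) (k₁≤ : k₁ ≤ rank (π₁ xs)) (k₂≤ : k₂ ≤ rank (π₂ xs)) where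

    -- The only place where the weight bounds enter. Each pattern of nonzero blocks has its own
    -- bound, matched with the rank of `xs`, of `π₁ xs` or of `π₂ xs`.
    annihilator≡0-++ : ∀ c₁ c₂ → C (c₁ ++ c₂) → (c₁ ++ c₂) ⊥ xs → c₁ ≡ zeroV × c₂ ≡ zeroV
    annihilator≡0-++ c₁ c₂ c∈ c⊥ with c₁ ≟ⱽ zeroV | c₂ ≟ⱽ zeroV | Equivalence.to (direct-sum c₁ c₂) c∈
    ... | yes c₁≡0 | yes c₂≡0 | _ = c₁≡0 , c₂≡0
    ... | no c₁≢0  | no c₂≢0  | c₁∈ , c₂∈ =
      contradiction c⊥ (heavy⇒¬⊥ xs∈ K≤ (weight-bound c₁ c₂ c₁∈ c₂∈ c₁≢0 c₂≢0))
    ... | no c₁≢0  | yes refl | c₁∈ , _   =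
      contradiction (⊥-π₁⁻ c₁ c⊥) (heavy⇒¬⊥ (in-π₁ xs∈) k₁≤ (proj₁ (proj₂ C₁-MRD) c₁ c₁∈ c₁≢0))
    ... | yes refl | no c₂≢0  | _ , c₂∈   =
      contradiction (⊥-π₂⁻ c₂ c⊥) (heavy⇒¬⊥ (in-π₂ xs∈) k₂≤ (proj₁ (proj₂ C₂-MRD) c₂ c₂∈ c₂≢0))

    annihilator≡0 : ∀ {c} → C c → c ⊥ xs → c ≡ zeroV {n₁} ++ zeroV
    annihilator≡0 {c} c∈ c⊥ =
      let eq₁ , eq₂ = annihilator≡0-++ (take n₁ c) (drop n₁ c)
                        (subst C (sym (Vec.take++drop≡id n₁ c)) c∈)
                        (subst (_⊥ xs) (sym (Vec.take++drop≡id n₁ c)) c⊥)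
      in trans (sym (Vec.take++drop≡id n₁ c)) (cong₂ _++_ eq₁ eq₂)

  -- Extending a tuple, and the exact number of annihilators

  Grows : ∀ {n r} → Vec Carrier n → Vec (Vec Carrier n) r → Set
  Grows {n} y ys = ¬ InSpan In ys y ⊎ n ≤ rank ys

  grow : ∀ {n r} (ys : Vec (Vec Carrier n) r) → ∃ λ y → All In y × Grows y ys
  grow {n} ys with rank ys <? n
  ... | yes lt = let y , y∈ , y∉ = rank<⇒escapes ys (subst (2 ≤_) (sym K-card) 2≤q) lt in y , y∈ , inj₁ y∉
  ... | no ¬lt = zeroV , SpanK.in-zeroV , inj₂ (≮⇒≥ ¬lt)

  -- If some projection can leave its span, concatenating the two block choices works, since leaving
  -- in one block forces leaving in the whole space. If both projections have full rank, they impose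
  -- nothing, and `x` may be chosen for `xs` alone.
  growAll : ∀ {r} (xs : Vec (Vec Carrier N) r) → ∃ λ x → All In x ×
            Grows x xs × Grows (take n₁ x) (π₁ xs) × Grows (drop n₁ x) (π₂ xs)
  growAll xs with grow (π₁ xs) | grow (π₂ xs)
  ... | x₁ , x₁∈ , inj₂ full₁ | x₂ , x₂∈ , inj₂ full₂ =
    let x , x∈ , gr = grow xs in x , x∈ , gr , inj₂ full₁ , inj₂ full₂
  ... | x₁ , x₁∈ , inj₁ x₁∉ | x₂ , x₂∈ , gr₂ = x₁ ++ x₂ , All-++ x₁∈ x₂∈ ,
    inj₁ (λ x∈ → x₁∉ (subst (InSpan In (π₁ xs)) (take-++ x₁ x₂) (span-π₁ x∈))) ,
    inj₁ (x₁∉ ∘ subst (InSpan In (π₁ xs)) (take-++ x₁ x₂)) ,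
    subst (λ y → Grows y (π₂ xs)) (sym (drop-++ x₁ x₂)) gr₂
  ... | x₁ , x₁∈ , inj₂ full₁ | x₂ , x₂∈ , inj₁ x₂∉ = x₁ ++ x₂ , All-++ x₁∈ x₂∈ ,
    inj₁ (λ x∈ → x₂∉ (subst (InSpan In (π₂ xs)) (drop-++ x₁ x₂) (span-π₂ x∈))) ,
    inj₂ full₁ ,
    inj₁ (x₂∉ ∘ subst (InSpan In (π₂ xs)) (drop-++ x₁ x₂))

  -- Either the rank rises by one and pays for the lost unit of `s`, or the rank is at least `n`,
  -- which exceeds `k`, and no deficit is left. The additive form avoids truncated subtraction.
  grows⇒deficit≤ : ∀ {n r k s} {y : Vec Carrier n} (ys : Vec (Vec Carrier n) r) → k < n → Grows y ys →
                   k ≤ suc s + rank ys → k ≤ s + rank (y ∷ ys)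
  grows⇒deficit≤ {k = k} {s} ys k<n (inj₁ y∉) le =
    subst (k ≤_) (sym (trans (cong (s +_) (rank-∉ ys y∉)) (+-suc s (rank ys)))) le
  grows⇒deficit≤ {k = k} {s} {y} ys k<n (inj₂ full) le =
    ≤-trans (<⇒≤ k<n) (≤-trans full (≤-trans (rank-∷-≥ y ys) (m≤n+m _ s)))

  -- Induction on a common bound for the deficits that lengthens the tuple: each step spends one
  -- factor `Q`, until only the zero codeword remains and `Q ^ 0` counts it.
  annihilators-upper : ∀ s {r} (xs : Vec (Vec Carrier N) r) → All (All In) xs →
    k₁ + k₂ ≤ s + rank xs → k₁ ≤ s + rank (π₁ xs) → k₂ ≤ s + rank (π₂ xs) →
    size (annihilators xs) ≤ Q ^ s
  annihilators-upper zero xs xs∈ K≤ k₁≤ k₂≤ =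
    Unique-⊆⇒length≤ {ys = (zeroV {n₁} ++ zeroV) ∷ []} (unique (annihilators xs))
      (λ c∈ → let cc , c⊥ = sound (annihilators xs) c∈ in here (annihilator≡0 xs∈ K≤ k₁≤ k₂≤ cc c⊥))
  annihilators-upper (suc s) xs xs∈ K≤ k₁≤ k₂≤ =
    let x , x∈ , gr , gr₁ , gr₂ = growAll xs in
    ≤-trans (annihilators-cut x xs) (*-monoʳ-≤ Q (annihilators-upper s (x ∷ xs) (x∈ ∷ xs∈)
      (grows⇒deficit≤ xs (+-mono-< k₁<n₁ k₂<n₂) gr K≤)
      (grows⇒deficit≤ (π₁ xs) k₁<n₁ gr₁ k₁≤)
      (grows⇒deficit≤ (π₂ xs) k₂<n₂ gr₂ k₂≤)))

  -- Padding with a zero block embeds the annihilators of `π₁ xs` in `C₁`, because the padded word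
  -- pairs with `x` only through its first block.
  annihilators-lower₁ : ∀ {r} (xs : Vec (Vec Carrier N) r) → Q ^ (k₁ ∸ rank (π₁ xs)) ≤ size (annihilators xs)
  annihilators-lower₁ xs = ≤-trans (Code₁.annihilators-lower (π₁ xs))
    (size-injection (Code₁.annihilators (π₁ xs)) (annihilators xs) (_++ zeroV)
      (λ {c₁} (c₁∈ , c₁⊥) → Equivalence.from (direct-sum c₁ zeroV) (c₁∈ , LinearCode.has-0 (proj₁ C₂-MRD)) , ⊥-π₁⁺ c₁ c₁⊥)
      (λ {c} {c′} _ _ → Vec.++-injectiveˡ c c′))

  annihilators-lower₂ : ∀ {r} (xs : Vec (Vec Carrier N) r) → Q ^ (k₂ ∸ rank (π₂ xs)) ≤ size (annihilators xs)
  annihilators-lower₂ xs = ≤-trans (Code₂.annihilators-lower (π₂ xs))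
    (size-injection (Code₂.annihilators (π₂ xs)) (annihilators xs) (zeroV {n₁} ++_)
      (λ {c₂} (c₂∈ , c₂⊥) → Equivalence.from (direct-sum zeroV c₂) (LinearCode.has-0 (proj₁ C₁-MRD) , c₂∈) , ⊥-π₂⁺ c₂ c₂⊥)
      (λ _ _ → Vec.++-injectiveʳ zeroV zeroV))

  size-annihilators : ∀ {r} (xs : Vec (Vec Carrier N) r) → All (All In) xs →
    size (annihilators xs) ≡ Q ^ exponent k₁ k₂ (rank xs) (rank (π₁ xs)) (rank (π₂ xs))
  size-annihilators xs xs∈ = ≤-antisym
    (annihilators-upper _ xs xs∈ (bound _ (m≤m⊔n e e₁₂))
      (bound _ (≤-trans (m≤m⊔n e₁ e₂) (m≤n⊔m e e₁₂)))
      (bound _ (≤-trans (m≤n⊔m e₁ e₂) (m≤n⊔m e e₁₂))))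
    (join e e₁₂ (annihilators-lower xs) (join e₁ e₂ (annihilators-lower₁ xs) (annihilators-lower₂ xs)))
    where
    e   = k₁ + k₂ ∸ rank xs
    e₁  = k₁ ∸ rank (π₁ xs)
    e₂  = k₂ ∸ rank (π₂ xs)
    e₁₂ = e₁ ⊔ e₂
    bound : ∀ {k s} r → k ∸ r ≤ s → k ≤ s + r
    bound {k} {s} r le = ≤-trans (m≤n+m∸n k r) (≤-trans (+-monoʳ-≤ r le) (≤-reflexive (+-comm r s)))
    join : ∀ x y {M} → Q ^ x ≤ M → Q ^ y ≤ M → Q ^ (x ⊔ y) ≤ M
    join x y {M} p p′ with ⊔-sel x y
    ... | inj₁ eq = subst (λ z → Q ^ z ≤ M) (sym eq) p
    ... | inj₂ eq = subst (λ z → Q ^ z ≤ M) (sym eq) p′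

  -- Counting the extensions of a tuple by their effect on the ranks

  inside outside : ∀ {n r} → Vec (Vec Carrier n) r → Vec Carrier n → ℕ
  inside  ys y = indicator (span? ys y)
  outside ys y = indicator (¬? (span? ys y))

  sumOver-inside : ∀ {n r} (ys : Vec (Vec Carrier n) r) → All (All In) ys →
                   sumOver (elems (Kvectors n)) (inside ys) ≡ q ^ rank ys
  sumOver-inside {n} ys ys∈ = begin
    sumOver (elems (Kvectors n)) (inside ys)   ≡⟨ length-filter (span? ys) (elems (Kvectors n)) ⟨
    size (restrict (Kvectors n) (span? ys))    ≡⟨ size-cong (restrict (Kvectors n) (span? ys)) (spanEnumeration ys) proj₂
                                                    (λ { y∈@(ks , ks∈ , refl) → SpanK.in-lincomb ks∈ ys∈ , y∈ }) ⟩
    size (spanEnumeration ys)                  ≡⟨ size-spanK ys ⟩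
    q ^ rank ys                                ∎
    where open ≡-Reasoning

  sumOver-outside : ∀ {n r} (ys : Vec (Vec Carrier n) r) → All (All In) ys →
                    sumOver (elems (Kvectors n)) (outside ys) ≡ q ^ n ∸ q ^ rank ys
  sumOver-outside {n} ys ys∈ = begin
    Σout                       ≡⟨ m+n∸m≡n Σin Σout ⟨
    Σin + Σout ∸ Σin           ≡⟨ cong₂ _∸_ total (sumOver-inside ys ys∈) ⟩
    q ^ n ∸ q ^ rank ys        ∎
    where
    open ≡-Reasoning
    Σin  = sumOver (elems (Kvectors n)) (inside ys)
    Σout = sumOver (elems (Kvectors n)) (outside ys)
    split : ∀ y → inside ys y + outside ys y ≡ 1
    split y with span? ys y
    ... | yes _ = refl
    ... | no _  = refl
    total : Σin + Σout ≡ q ^ n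
    total = begin
      Σin + Σout                                                      ≡⟨ sumOver-+ (elems (Kvectors n)) (inside ys) (outside ys) ⟨
      sumOver (elems (Kvectors n)) (λ y → inside ys y + outside ys y) ≡⟨ sumOver-cong (elems (Kvectors n)) (λ {y} _ → split y) ⟩
      sumOver (elems (Kvectors n)) (λ _ → 1)                          ≡⟨ sumOver-const (elems (Kvectors n)) 1 ⟩
      size (Kvectors n) * 1                                           ≡⟨ *-identityʳ _ ⟩
      size (Kvectors n)                                               ≡⟨ size-Kvectors n ⟩
      q ^ n                                                           ∎

  -- The correction on the left stands in for a subtraction on the right.
  classify : ∀ (g : ℕ → ℕ → ℕ → ℕ) {r} (xs : Vec (Vec Carrier N) r) x →
    let u = rank xs ; a = rank (π₁ xs) ; b = rank (π₂ xs) in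
    g (rank (x ∷ xs)) (rank (π₁ (x ∷ xs))) (rank (π₂ (x ∷ xs))) + inside xs x * g (suc u) a b
    ≡ inside xs x * g u a b
      + (inside (π₁ xs) (take n₁ x) * inside (π₂ xs) (drop n₁ x) * g (suc u) a b
      + (inside (π₁ xs) (take n₁ x) * outside (π₂ xs) (drop n₁ x) * g (suc u) a (suc b)
      + (outside (π₁ xs) (take n₁ x) * inside (π₂ xs) (drop n₁ x) * g (suc u) (suc a) b
      + outside (π₁ xs) (take n₁ x) * outside (π₂ xs) (drop n₁ x) * g (suc u) (suc a) (suc b))))
  classify g xs x with span? xs x | span? (π₁ xs) (take n₁ x) | span? (π₂ xs) (drop n₁ x)
  ... | yes x∈ | no x₁∉ | _      = contradiction (span-π₁ x∈) x₁∉
  ... | yes x∈ | yes _  | no x₂∉ = contradiction (span-π₂ x∈) x₂∉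
  ... | yes _  | yes _  | yes _  = cong₂ _+_
    (sym (+-identityʳ (g (rank xs) (rank (π₁ xs)) (rank (π₂ xs)))))
    (sym (+-identityʳ (1 * g (suc (rank xs)) (rank (π₁ xs)) (rank (π₂ xs)))))
  ... | no _   | yes _  | yes _  = cong (_+ 0) (sym (+-identityʳ _))
  ... | no _   | yes _  | no _   = cong (_+ 0) (sym (+-identityʳ _))
  ... | no _   | no _   | yes _  = cong (_+ 0) (sym (+-identityʳ _))
  ... | no _   | no _   | no _   = trans (+-identityʳ _) (sym (+-identityʳ _))

  -- Conditions on the two projections factor over the blocks, so their counts are products. The
  -- condition that `x` is in the span does not factor, but it implies both others; it therefore
  -- only splits the class where both projections are inside, and its own count is `q ^ u`.
  sumOver-extensions : ∀ (g : ℕ → ℕ → ℕ → ℕ) {r} (xs : Vec (Vec Carrier N) r) → All (All In) xs →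
    let u = rank xs ; a = rank (π₁ xs) ; b = rank (π₂ xs) in
    sumOver (elems (Kvectors N)) (λ x → g (rank (x ∷ xs)) (rank (π₁ (x ∷ xs))) (rank (π₂ (x ∷ xs))))
      + q ^ u * g (suc u) a b
    ≡ q ^ u * g u a b
      + (q ^ a * q ^ b * g (suc u) a b
      + (q ^ a * (q ^ n₂ ∸ q ^ b) * g (suc u) a (suc b)
      + ((q ^ n₁ ∸ q ^ a) * q ^ b * g (suc u) (suc a) b
      + (q ^ n₁ ∸ q ^ a) * (q ^ n₂ ∸ q ^ b) * g (suc u) (suc a) (suc b))))
  sumOver-extensions g xs xs∈ = begin
    Σ′ G + q ^ u′ * γ                    ≡⟨ cong (Σ′ G +_) (times i γ (sumOver-inside xs xs∈)) ⟨
    Σ′ G + Σ′ (λ x → i x * γ)            ≡⟨ sumOver-+ Ks G (λ x → i x * γ) ⟨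
    Σ′ (λ x → G x + i x * γ)             ≡⟨ sumOver-cong Ks (λ {x} _ → classify g xs x) ⟩
    Σ′ (λ x → f₁ x + (f₂ x + (f₃ x + (f₄ x + f₅ x))))
      ≡⟨ trans (sumOver-+ Ks f₁ _) (cong (Σ′ f₁ +_)
           (trans (sumOver-+ Ks f₂ _) (cong (Σ′ f₂ +_)
             (trans (sumOver-+ Ks f₃ _) (cong (Σ′ f₃ +_) (sumOver-+ Ks f₄ f₅)))))) ⟩
    Σ′ f₁ + (Σ′ f₂ + (Σ′ f₃ + (Σ′ f₄ + Σ′ f₅)))
      ≡⟨ cong₂ _+_ (times i _ (sumOver-inside xs xs∈))
           (cong₂ _+_ (times _ _ (product _ _ in₁ in₂))
             (cong₂ _+_ (times _ _ (product _ _ in₁ out₂))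
               (cong₂ _+_ (times _ _ (product _ _ out₁ in₂))
                          (times _ _ (product _ _ out₁ out₂))))) ⟩
    _ ∎
    where
    open ≡-Reasoning
    Ks = elems (Kvectors N)
    u′ = rank xs
    a′ = rank (π₁ xs)
    b′ = rank (π₂ xs)
    γ  = g (suc u′) a′ b′
    Σ′ : (Vec Carrier N → ℕ) → ℕ
    Σ′ = sumOver Ks
    G i f₁ f₂ f₃ f₄ f₅ : Vec Carrier N → ℕ
    G x = g (rank (x ∷ xs)) (rank (π₁ (x ∷ xs))) (rank (π₂ (x ∷ xs)))
    i   = inside xs
    f₁ x = i x * g u′ a′ b′
    f₂ x = inside (π₁ xs) (take n₁ x) * inside (π₂ xs) (drop n₁ x) * γ
    f₃ x = inside (π₁ xs) (take n₁ x) * outside (π₂ xs) (drop n₁ x) * g (suc u′) a′ (suc b′)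
    f₄ x = outside (π₁ xs) (take n₁ x) * inside (π₂ xs) (drop n₁ x) * g (suc u′) (suc a′) b′
    f₅ x = outside (π₁ xs) (take n₁ x) * outside (π₂ xs) (drop n₁ x) * g (suc u′) (suc a′) (suc b′)
    times : ∀ f k {s} → Σ′ f ≡ s → Σ′ (λ x → f x * k) ≡ s * k
    times f k eq = trans (sumOver-*ʳ Ks f k) (cong (_* k) eq)
    product : ∀ (f₁ : Vec Carrier n₁ → ℕ) (f₂ : Vec Carrier n₂ → ℕ) {s₁ s₂} →
              sumOver (elems (Kvectors n₁)) f₁ ≡ s₁ → sumOver (elems (Kvectors n₂)) f₂ ≡ s₂ →
              Σ′ (λ x → f₁ (take n₁ x) * f₂ (drop n₁ x)) ≡ s₁ * s₂
    product f₁ f₂ eq₁ eq₂ = trans (sumOver-take-drop K-elems n₁ f₁ f₂) (cong₂ _*_ eq₁ eq₂)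
    in₁  = sumOver-inside (π₁ xs) (in-π₁ xs∈)
    in₂  = sumOver-inside (π₂ xs) (in-π₂ xs∈)
    out₁ = sumOver-outside (π₁ xs) (in-π₁ xs∈)
    out₂ = sumOver-outside (π₂ xs) (in-π₂ xs∈)

  tupleSum≡momentFrom : ∀ t {r} (xs : Vec (Vec Carrier N) r) → All (All In) xs →
    tupleSum t xs ≡ momentFrom q m n₁ n₂ k₁ k₂ t (rank xs) (rank (π₁ xs)) (rank (π₂ xs))
  tupleSum≡momentFrom zero    xs xs∈ = size-annihilators xs xs∈
  tupleSum≡momentFrom (suc t) xs xs∈ = begin
    sumOver Ks (λ x → tupleSum t (x ∷ xs))
      ≡⟨ sumOver-cong Ks (λ {x} x∈ → tupleSum≡momentFrom t (x ∷ xs) (sound (Kvectors N) x∈ ∷ xs∈)) ⟩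
    sumOver Ks G
      -- The truncated subtraction in `momentFrom` is exact because it removes a term that has just
      -- been added.
      ≡⟨ m+n∸n≡m (sumOver Ks G) correction ⟨
    sumOver Ks G + correction ∸ correction
      ≡⟨ cong (_∸ correction) (sumOver-extensions g xs xs∈) ⟩
    momentFrom q m n₁ n₂ k₁ k₂ (suc t) (rank xs) (rank (π₁ xs)) (rank (π₂ xs))
      ∎
    where
    open ≡-Reasoning
    Ks = elems (Kvectors N)
    g = momentFrom q m n₁ n₂ k₁ k₂ t
    G : Vec Carrier N → ℕ
    G x = g (rank (x ∷ xs)) (rank (π₁ (x ∷ xs))) (rank (π₂ (x ∷ xs)))
    correction = q ^ rank xs * g (suc (rank xs)) (rank (π₁ xs)) (rank (π₂ xs))

  moment : ∀ t → sumOver (elems codewords) (λ c → size (kernel c) ^ t) ≡ momentFrom q m n₁ n₂ k₁ k₂ t 0 0 0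
  moment t = begin
    sumOver (elems codewords) (λ c → size (kernel c) ^ t)
      -- The factor 1 is the indicator of orthogonality to the empty tuple.
      ≡⟨ sumOver-cong (elems codewords) (λ _ → sym (*-identityˡ _)) ⟩
    sumOver (elems codewords) (λ c → 1 * size (kernel c) ^ t)
      ≡⟨ tupleSum≡moment t [] ⟨
    tupleSum t []
      ≡⟨ tupleSum≡momentFrom t [] [] ⟩
    momentFrom q m n₁ n₂ k₁ k₂ t 0 0 0
      ∎
    where open ≡-Reasoning

-- Power sums

open import Data.Integer using (+_)

sumOverℤ : List ℕ → (ℕ → ℤ) → ℤ
sumOverℤ []       f = + 0
sumOverℤ (y ∷ ys) f = f y ℤ.+ sumOverℤ ys f

sumOverℤ-cong : ∀ ys {f g : ℕ → ℤ} → (∀ {y} → y ∈ ys → f y ≡ g y) → sumOverℤ ys f ≡ sumOverℤ ys g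
sumOverℤ-cong []       eq = refl
sumOverℤ-cong (y ∷ ys) eq = cong₂ ℤ._+_ (eq (here refl)) (sumOverℤ-cong ys (eq ∘ there))

sumOverℤ-pos : ∀ ys (f : ℕ → ℕ) → sumOverℤ ys (λ y → + f y) ≡ + sumOver ys f
sumOverℤ-pos []       f = refl
sumOverℤ-pos (y ∷ ys) f = cong (λ s → + f y ℤ.+ s) (sumOverℤ-pos ys f)

sumOverℤ-linear : ∀ r ys (f g : ℕ → ℤ) →
  sumOverℤ ys (λ y → f y ℤ.- r ℤ.* g y) ≡ sumOverℤ ys f ℤ.- r ℤ.* sumOverℤ ys g
sumOverℤ-linear r []       f g = solve 1 (λ r → con (+ 0) := con (+ 0) :- r :* con (+ 0)) refl r
  where open +-*-Solver
sumOverℤ-linear r (y ∷ ys) f g = trans (cong (λ s → (f y ℤ.- r ℤ.* g y) ℤ.+ s) (sumOverℤ-linear r ys f g))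
  (solve 5 (λ a b r s t → (a :- r :* b) :+ (s :- r :* t) := (a :+ s) :- r :* (b :+ t)) refl
    (f y) (g y) r (sumOverℤ ys f) (sumOverℤ ys g))
  where open +-*-Solver

sumOverℤ-*ʳ : ∀ k ys (f : ℕ → ℤ) → sumOverℤ ys (λ y → f y ℤ.* k) ≡ sumOverℤ ys f ℤ.* k
sumOverℤ-*ʳ k []       f = refl
sumOverℤ-*ʳ k (y ∷ ys) f =
  trans (cong (λ s → f y ℤ.* k ℤ.+ s) (sumOverℤ-*ʳ k ys f)) (sym (ℤ.*-distribʳ-+ k (f y) (sumOverℤ ys f)))

-- The monic polynomial with roots `rs`, evaluated at `y`; integers are used because factors can be
-- negative.
vanishingAt : List ℕ → ℕ → ℤ
vanishingAt []       y = + 1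
vanishingAt (r ∷ rs) y = (+ y ℤ.- + r) ℤ.* vanishingAt rs y

vanishingAt-∈ : ∀ {rs y} → y ∈ rs → vanishingAt rs y ≡ + 0
vanishingAt-∈ {_ ∷ rs} {y} (here refl) =
  trans (cong (ℤ._* vanishingAt rs y) (ℤ.+-inverseʳ (+ y))) (ℤ.*-zeroˡ (vanishingAt rs y))
vanishingAt-∈ {r ∷ _}  {y} (there y∈)  =
  trans (cong ((+ y ℤ.- + r) ℤ.*_) (vanishingAt-∈ y∈)) (ℤ.*-zeroʳ (+ y ℤ.- + r))

vanishingAt-∉ : ∀ {rs y} → ¬ y ∈ rs → vanishingAt rs y ≢ + 0
vanishingAt-∉ {r ∷ rs} {y} y∉ eq with ℤ.i*j≡0⇒i≡0∨j≡0 (+ y ℤ.- + r) eq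
... | inj₁ y-r≡0 = y∉ (here (ℤ.+-injective (ℤ.i-j≡0⇒i≡j (+ y) (+ r) y-r≡0)))
... | inj₂ rest  = vanishingAt-∉ (y∉ ∘ there) rest

module _ {ys ys′ : List ℕ} (powerSums : ∀ t → sumOver ys (_^ t) ≡ sumOver ys′ (_^ t)) where

  -- A further factor `y - r` turns the sum at `t` into the sum at `suc t` minus `r` times the sum
  -- at `t`. Keeping the factor `y ^ t` general thus avoids expanding the polynomial.
  polynomialSums : ∀ rs t → sumOverℤ ys  (λ y → + (y ^ t) ℤ.* vanishingAt rs y)
                          ≡ sumOverℤ ys′ (λ y → + (y ^ t) ℤ.* vanishingAt rs y)
  polynomialSums [] t = trans (asℕ ys) (trans (cong +_ (powerSums t)) (sym (asℕ ys′)))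
    where
    asℕ : ∀ zs → sumOverℤ zs (λ y → + (y ^ t) ℤ.* + 1) ≡ + sumOver zs (_^ t)
    asℕ zs = trans (sumOverℤ-cong zs (λ _ → ℤ.*-identityʳ _)) (sumOverℤ-pos zs (_^ t))
  polynomialSums (r ∷ rs) t = trans (expand ys) (trans
    (cong₂ (λ a b → a ℤ.- + r ℤ.* b) (polynomialSums rs (suc t)) (polynomialSums rs t))
    (sym (expand ys′)))
    where
    F : ℕ → ℕ → ℤ
    F t y = + (y ^ t) ℤ.* vanishingAt rs y
    term : ∀ y → + (y ^ t) ℤ.* vanishingAt (r ∷ rs) y ≡ F (suc t) y ℤ.- + r ℤ.* F t y
    term y = trans
      (solve 4 (λ p y r v → p :* ((y :- r) :* v) := (y :* p) :* v :- r :* (p :* v)) refl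
        (+ (y ^ t)) (+ y) (+ r) (vanishingAt rs y))
      (cong (λ z → z ℤ.* vanishingAt rs y ℤ.- + r ℤ.* F t y) (sym (ℤ.pos-* y (y ^ t))))
      where open +-*-Solver
    expand : ∀ zs → sumOverℤ zs (λ y → + (y ^ t) ℤ.* vanishingAt (r ∷ rs) y)
                    ≡ sumOverℤ zs (F (suc t)) ℤ.- + r ℤ.* sumOverℤ zs (F t)
    expand zs = trans (sumOverℤ-cong zs (λ {y} _ → term y)) (sumOverℤ-linear (+ r) zs (F (suc t)) (F t))

  -- Lagrange: a polynomial vanishing at every other value isolates the multiplicity of y.
  powerSums⇒multiplicities : ∀ y → sumOver ys (λ z → indicator (z ℕ.≟ y)) ≡ sumOver ys′ (λ z → indicator (z ℕ.≟ y))
  powerSums⇒multiplicities y = ℤ.+-injective (ℤ.*-cancelʳ-≡ _ _ v {{ℤ.≢-nonZero v≢0}} (begin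
    + sumOver ys δ ℤ.* v                                        ≡⟨ isolate ys ∈.∈-++⁺ˡ ⟨
    sumOverℤ ys  (λ z → + (z ^ 0) ℤ.* vanishingAt others z)     ≡⟨ polynomialSums others 0 ⟩
    sumOverℤ ys′ (λ z → + (z ^ 0) ℤ.* vanishingAt others z)     ≡⟨ isolate ys′ (∈.∈-++⁺ʳ ys) ⟩
    + sumOver ys′ δ ℤ.* v                                       ∎))
    where
    open ≡-Reasoning
    δ : ℕ → ℕ
    δ z = indicator (z ℕ.≟ y)
    -- The values of both lists are collected, so that one polynomial isolates `y` in either of
    -- them.
    others = filter (λ z → ¬? (z ℕ.≟ y)) (ys List.++ ys′)
    v = vanishingAt others y
    v≢0 : v ≢ + 0
    v≢0 = vanishingAt-∉ (λ y∈ → proj₂ (∈-filter⁻ (λ z → ¬? (z ℕ.≟ y)) {xs = ys List.++ ys′} y∈) refl)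
    isolate : ∀ zs → (∀ {z} → z ∈ zs → z ∈ ys List.++ ys′) →
              sumOverℤ zs (λ z → + (z ^ 0) ℤ.* vanishingAt others z) ≡ + sumOver zs δ ℤ.* v
    isolate zs sub = trans (sumOverℤ-cong zs term)
      (trans (sumOverℤ-*ʳ v zs (λ z → + δ z)) (cong (ℤ._* v) (sumOverℤ-pos zs δ)))
      where
      term : ∀ {z} → z ∈ zs → + 1 ℤ.* vanishingAt others z ≡ + δ z ℤ.* v
      term {z} z∈ with z ℕ.≟ y
      ... | yes refl = cong (λ d → + d ℤ.* v) (sym (indicator-yes (z ℕ.≟ z) refl))
      ... | no z≢y   = trans (ℤ.*-identityˡ _)
        (trans (vanishingAt-∈ (∈-filter⁺ (λ z → ¬? (z ℕ.≟ y)) (sub z∈) z≢y))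
          (sym (cong (λ d → + d ℤ.* v) (indicator-no (z ℕ.≟ y) z≢y))))

-- From kernel sizes back to weights

module WeightCounts {q m n k : ℕ} (E : Extension q m) {C : Vec (Extension.Carrier E) n → Set}
                    (code : Codes.LinearCode E n k C) where
  open Extension E hiding (_+_; _*_)
  open Codes E
  open FiniteExtension E
  open Annihilators code

  kernelSizes : List ℕ
  kernelSizes = List.map (λ c → size (kernel c)) (elems codewords)

  sumOver-kernelSizes : ∀ f → sumOver kernelSizes f ≡ sumOver (elems codewords) (λ c → f (size (kernel c)))
  sumOver-kernelSizes = sumOver-map (λ c → size (kernel c)) (elems codewords)

  -- Rank-nullity read in both directions: `q` is at least 2, so powers determine exponents, and
  -- `i ≤ n` keeps `n ∸ i` from truncating. For the converse, every vector has some rank weight, and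
  -- this is then forced to be `i`.
  weight⇔kernelSize : ∀ {i} → i ≤ n → ∀ {c : Vec Carrier n} →
    (RankWeight c i → size (kernel c) ≡ q ^ (n ∸ i)) × (size (kernel c) ≡ q ^ (n ∸ i) → RankWeight c i)
  weight⇔kernelSize {i} i≤n {c} = to , from
    where
    open ≡-Reasoning
    instance
      qⁱ-nonZero : NonZero (q ^ i)
      qⁱ-nonZero = m^n≢0 q i
    to : RankWeight c i → size (kernel c) ≡ q ^ (n ∸ i)
    to h = *-cancelʳ-≡ _ _ (q ^ i) (begin
      size (kernel c) * q ^ i     ≡⟨ rank-nullity h ⟩
      q ^ n                       ≡⟨ cong (q ^_) (m∸n+n≡m i≤n) ⟨
      q ^ (n ∸ i + i)             ≡⟨ ^-distribˡ-+-* q (n ∸ i) i ⟩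
      q ^ (n ∸ i) * q ^ i         ∎)
    from : size (kernel c) ≡ q ^ (n ∸ i) → RankWeight c i
    from eq with rankWeight c
    ... | r , h = subst (RankWeight c) (+-cancelˡ-≡ (n ∸ i) r i (trans
            (≤-antisym (^-cancelʳ-≤ q 2≤q (≤-reflexive powers)) (^-cancelʳ-≤ q 2≤q (≤-reflexive (sym powers))))
            (sym (m∸n+n≡m i≤n)))) h
      where
      powers : q ^ (n ∸ i + r) ≡ q ^ n
      powers = begin
        q ^ (n ∸ i + r)           ≡⟨ ^-distribˡ-+-* q (n ∸ i) r ⟩
        q ^ (n ∸ i) * q ^ r       ≡⟨ cong (_* q ^ r) eq ⟨
        size (kernel c) * q ^ r   ≡⟨ rank-nullity h ⟩
        q ^ n                     ∎

  -- Trading the weight condition for a decidable equation between numbers allows filtering the list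
  -- of codewords, whatever list witnesses the weight count.
  weightCount≡ : ∀ {i a} → i ≤ n → WeightCount C i a →
                 a ≡ sumOver kernelSizes (λ y → indicator (y ℕ.≟ q ^ (n ∸ i)))
  weightCount≡ {i} i≤n (xs , uniq , snd , compl , refl) = begin
    length xs
      ≡⟨ size-cong weighted (restrict codewords (λ c → size (kernel c) ℕ.≟ q ^ (n ∸ i)))
           (λ {c} (cc , h) → cc , proj₁ (weight⇔kernelSize i≤n {c}) h)
           (λ {c} (cc , eq) → cc , proj₂ (weight⇔kernelSize i≤n {c}) eq) ⟩
    size (restrict codewords (λ c → size (kernel c) ℕ.≟ q ^ (n ∸ i)))
      ≡⟨ length-filter (λ c → size (kernel c) ℕ.≟ q ^ (n ∸ i)) (elems codewords) ⟩
    sumOver (elems codewords) (λ c → indicator (size (kernel c) ℕ.≟ q ^ (n ∸ i)))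
      ≡⟨ sumOver-kernelSizes (λ y → indicator (y ℕ.≟ q ^ (n ∸ i))) ⟨
    sumOver kernelSizes (λ y → indicator (y ℕ.≟ q ^ (n ∸ i)))
      ∎
    where
    open ≡-Reasoning
    weighted : Enumeration (λ c → C c × RankWeight c i)
    weighted = record { elems = xs ; unique = uniq ; sound = ListAll.lookup snd ; complete = λ (cc , h) → compl _ cc h }

theorem2p29 : (q m n₁ n₂ k₁ k₂ : ℕ) →
    k₁ < n₁ → n₁ ≤ m → k₂ < n₂ → n₂ ≤ m →
    (E E′ : Extension q m) →
    (C : Vec (Extension.Carrier E) (n₁ + n₂) → Set) → Codes.SumMRD E n₁ n₂ k₁ k₂ C →
    (C′ : Vec (Extension.Carrier E′) (n₁ + n₂) → Set) → Codes.SumMRD E′ n₁ n₂ k₁ k₂ C′ →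
    (i a a′ : ℕ) → i ≤ n₁ + n₂ →
    Codes.WeightCount E C i a → Codes.WeightCount E′ C′ i a′ → a ≡ a′
theorem2p29 q m n₁ n₂ k₁ k₂ k₁<n₁ _ k₂<n₂ _ E E′ C S C′ S′ i a a′ i≤N wc wc′ = begin
  a                                                ≡⟨ W.weightCount≡ i≤N wc ⟩
  sumOver W.kernelSizes (λ y → indicator (y ℕ.≟ q ^ (n₁ + n₂ ∸ i)))
    ≡⟨ powerSums⇒multiplicities {W.kernelSizes} {W′.kernelSizes} powerSums (q ^ (n₁ + n₂ ∸ i)) ⟩
  sumOver W′.kernelSizes (λ y → indicator (y ℕ.≟ q ^ (n₁ + n₂ ∸ i)))
    ≡⟨ W′.weightCount≡ i≤N wc′ ⟨
  a′                                               ∎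
  where
  open ≡-Reasoning
  module W  = WeightCounts E  (Codes.SumMRD.code S)
  module W′ = WeightCounts E′ (Codes.SumMRD.code S′)
  -- The two codes, possibly over different extensions, meet in a number that is built from the
  -- parameters alone.
  powerSums : ∀ t → sumOver W.kernelSizes (_^ t) ≡ sumOver W′.kernelSizes (_^ t)
  powerSums t = begin
    sumOver W.kernelSizes (_^ t)         ≡⟨ W.sumOver-kernelSizes (_^ t) ⟩
    _                                    ≡⟨ SumCode.moment E k₁<n₁ k₂<n₂ S t ⟩
    momentFrom q m n₁ n₂ k₁ k₂ t 0 0 0   ≡⟨ SumCode.moment E′ k₁<n₁ k₂<n₂ S′ t ⟨
    _                                    ≡⟨ W′.sumOver-kernelSizes (_^ t) ⟨
    sumOver W′.kernelSizes (_^ t)        ∎
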